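{- Let $\mathbb{P}$ be the phase hyperfield and let $f:\mathbb{C}\to\mathbb{P}$ be the hyperfield homomorphism with $f(0)=0$ and $f(z)=z/|z|$ for $z\neq0$. Let $$\overline{p}(T)=T^3+e^{i\pi/24}T^2+e^{i\pi/2}T+e^{23i\pi/24},$$ a polynomial over $\mathbb{P}$. Then $\mathrm{mult}_{ -1}(\overline{p})=2$, and for every polynomial $p\in\mathbb{C}[T]$ corresponding to $\overline{p}$ with respect to $f$ (that is, $p(T)=c_3T^3+c_2T^2+c_1T+c_0$ with $f(c_3)=1$, $f(c_2)=e^{i\pi/24}$, $f(c_1)=e^{i\pi/2}$, $f(c_0)=e^{23i\pi/24}$) one has $$\mathrm{mult}_{ -1}(\overline{p})=2>\sum_{a\in\mathbb{R},\ a<0}\mathrm{mult}_a(p).$$ In particular, the inequality $\mathrm{mult}_b(\overline{p})\ge\sum_{a\in f^{ -1}(b)}\mathrm{mult}_a(p)$ is not sharp under $f:\mathbb{C}\to\mathbb{P}$: for this $\overline{p}$ and $b=-1$, no corresponding polynomial $p$ attains equality.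
   Context: The phase hyperfield $\mathbb{P}$ is the set $S^1\cup\{0\}$, $S^1=\{z\in\mathbb{C}:|z|=1\}$, with the usual multiplication and the commutative hyperaddition given by $x\boxplus 0=\{x\}$; $x\boxplus(-x)=\{0,x,-x\}$; and otherwise $x\boxplus y=\left\{\frac{\alpha x+\beta y}{|\alpha x+\beta y|}:\alpha,\beta\in\mathbb{R}_{>0}\right\}$. For subsets, $A\boxplus B=\bigcup_{a\in A,b\in B}a\boxplus b$, and iterated hypersums are defined accordingly. A polynomial over a hyperfield $\mathbb{F}$ is a formal expression $p(T)=c_nT^n+\cdots+c_1T+c_0$ with $c_i\in\mathbb{F}$, $c_n\ne0$ (degree $n$). For polynomials $p=\sum_{k\le n} c_kT^k$ and $q=\sum_{l\le m} d_lT^l$, the product $p\boxdot q$ is the set of all $\sum_{i=0}^{n+m}e_iT^i$ with $e_i\in\boxplus_{k+l=i}c_kd_l$ for every $i$. An element $a\in\mathbb{F}$ is a root of $p$ if $0\in c_na^n\boxplus\cdots\boxplus c_1a\boxplus c_0$ (equivalently, $p\in(T-a)\boxdot q$ for some polynomial $q$ over $\mathbb{F}$). The multiplicity is defined recursively: $\mathrm{mult}_a(p)=0$ if $a$ is not a root of $p$, and otherwise $\mathrm{mult}_a(p)=1+\max\{\mathrm{mult}_a(q): p\in(T-a)\boxdot q\}$. For a field (viewed as a hyperfield with $x\boxplus y=\{x+y\}$) this is the usual multiplicity of a root. -}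

module Defs where

open import Level using (0ℓ)
open import Algebra.Bundles using (CommutativeRing)
open import Algebra.Structures using (IsCommutativeRing)
import Algebra.Properties.Ring as RingProperties
open import Data.Empty using (⊥; ⊥-elim)
open import Data.Fin.Base as Fin using (Fin; zero; suc; toℕ)
open import Data.List.Base using (List; []; _∷_; map; filter; allFin; cartesianProduct)
open import Data.List.Membership.Propositional using () renaming (_∉_ to _∉ₗ_)
open import Data.List.Relation.Unary.All using (All)
open import Data.List.Relation.Unary.Unique.Propositional using (Unique)
open import Data.Nat.ListAction using (sum)
open import Data.Nat.Base as ℕ using (ℕ; zero; suc)
import Data.Nat.Properties as ℕ
open import Data.Product.Base using (_×_; _,_; ∃; ∃-syntax; proj₁; proj₂)
open import Data.Sum.Base using (_⊎_; inj₁; inj₂)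
open import Relation.Binary.Structures using (IsDecTotalOrder)
import Relation.Binary.Construct.NonStrictToStrict as Strict
open import Relation.Binary.PropositionalEquality
open import Relation.Nullary using (¬_; Dec; yes; no)
open import Relation.Nullary.Decidable using (map′; _×-dec_)
open import Relation.Unary using (Pred; _∈_; Satisfiable; ｛_｝)

-- The operations of a hyperfield.  The hyperaxioms play no role in the
-- definitions below, so they are not part of the record.

record RawHyperfield : Set₁ where
  infix  8 -_
  infixr 8 _^_
  infixl 7 _*_
  infixl 6 _⊞_ _⊞ˢ_
  field
    Carrier : Set
    0# 1#   : Carrier
    -_      : Carrier → Carrier
    _*_     : Carrier → Carrier → Carrier
    _⊞_     : Carrier → Carrier → Pred Carrier 0ℓ
    1≢0     : 1# ≢ 0#

  _⊞ˢ_ : Pred Carrier 0ℓ → Pred Carrier 0ℓ → Pred Carrier 0ℓ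
  (A ⊞ˢ B) z = ∃[ a ] ∃[ b ] a ∈ A × b ∈ B × z ∈ a ⊞ b

  ⊞-sum : List Carrier → Pred Carrier 0ℓ
  ⊞-sum []       = ｛ 0# ｝
  ⊞-sum (x ∷ xs) = ｛ x ｝ ⊞ˢ ⊞-sum xs

  _^_ : Carrier → ℕ → Carrier
  x ^ zero  = 1#
  x ^ suc n = x * x ^ n

module _ (F : RawHyperfield) where
  open RawHyperfield F

  record Polynomial (n : ℕ) : Set where
    field
      coeff     : Fin (suc n) → Carrier
      leading≢0 : coeff (Fin.fromℕ n) ≢ 0#

open Polynomial public

module _ {F : RawHyperfield} where
  open RawHyperfield F

  infix 4 _∈_⊡_

  _∈_⊡_ : ∀ {n m} → Polynomial F (n ℕ.+ m) → Polynomial F n → Polynomial F m → Set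
  _∈_⊡_ {n} {m} e p q =
    ∀ i → coeff e i ∈ ⊞-sum (map (λ (k , l) → coeff p k * coeff q l) (indices (toℕ i)))
    where
    indices : ℕ → List (Fin (suc n) × Fin (suc m))
    indices i = filter (λ (k , l) → toℕ k ℕ.+ toℕ l ℕ.≟ i)
                       (cartesianProduct (allFin (suc n)) (allFin (suc m)))

  T-_ : Carrier → Polynomial F 1
  T- a = record
    { coeff     = λ { zero → - a ; (suc zero) → 1# }
    ; leading≢0 = 1≢0
    }

  Root : ∀ {n} → Carrier → Polynomial F n → Set
  Root {n} a p = 0# ∈ ⊞-sum (map (λ k → coeff p k * a ^ toℕ k) (allFin (suc n)))

  IsMax : Pred ℕ 0ℓ → ℕ → Set
  IsMax A k = k ∈ A × (∀ {j} → j ∈ A → j ℕ.≤ k)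

  -- Mult a p m says that mult_a(p) = m.  QuotientMult a p is the set of
  -- the numbers mult_a(q) with p ∈ (T - a) ⊡ q.  Such a q has degree
  -- deg p - 1, as leading coefficients multiply to a nonzero element.

  Mult         : ∀ {n} → Carrier → Polynomial F n → Pred ℕ 0ℓ
  QuotientMult : ∀ {n} → Carrier → Polynomial F n → Pred ℕ 0ℓ

  Mult a p m = (¬ Root a p × m ≡ 0)
             ⊎ (Root a p × ∃[ k ] m ≡ suc k × IsMax (QuotientMult a p) k)

  QuotientMult {zero}  a p k = ⊥
  QuotientMult {suc n} a p k =
    ∃[ q ] _∈_⊡_ {1} {n} p (T- a) q × Mult a q k

  -- MultSum A p s says that the sum of mult_a(p) over all a ∈ A is s: the
  -- elements of A outside a finite list contribute 0.

  MultSum : ∀ {n} → Pred Carrier 0ℓ → Polynomial F n → Pred ℕ 0ℓ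
  MultSum A p s = ∃[ ams ]
      Unique (map proj₁ ams)
    × All (λ (a , m) → a ∈ A × Mult a p m) ams
    × (∀ a → a ∈ A → a ∉ₗ map proj₁ ams → Mult a p 0)
    × sum (map proj₂ ams) ≡ s

Corresponds : ∀ {F G n} → (RawHyperfield.Carrier F → RawHyperfield.Carrier G) →
              Polynomial F n → Polynomial G n → Set
Corresponds f p p̄ = ∀ i → f (coeff p i) ≡ coeff p̄ i

-- The real numbers are the complete ordered field, unique up to unique
-- isomorphism.

record RealNumbers : Set₁ where
  infix  8 -_
  infix  9 _⁻¹
  infixl 7 _*_
  infixl 6 _+_
  infix  4 _≤_
  field
    ℝ                 : Set
    _≤_               : ℝ → ℝ → Set
    _+_ _*_           : ℝ → ℝ → ℝ
    -_ _⁻¹            : ℝ → ℝ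
    0# 1#             : ℝ
    isCommutativeRing : IsCommutativeRing _≡_ _+_ _*_ -_ 0# 1#
    1≢0               : 1# ≢ 0#
    *-inverseʳ        : ∀ {x} → x ≢ 0# → x * x ⁻¹ ≡ 1#
    isDecTotalOrder   : IsDecTotalOrder _≡_ _≤_
    +-monoʳ-≤         : ∀ x {y z} → y ≤ z → x + y ≤ x + z
    *-nonneg          : ∀ {x y} → 0# ≤ x → 0# ≤ y → 0# ≤ x * y

  UpperBound : Pred ℝ 0ℓ → Pred ℝ 0ℓ
  UpperBound A u = ∀ {x} → x ∈ A → x ≤ u

  field
    supremum : ∀ (A : Pred ℝ 0ℓ) → Satisfiable A → Satisfiable (UpperBound A) →
               ∃[ s ] s ∈ UpperBound A × (∀ {u} → u ∈ UpperBound A → s ≤ u)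

  open IsDecTotalOrder isDecTotalOrder public
    using (_≟_; _≤?_)
    renaming ( refl to ≤-refl; reflexive to ≤-reflexive; trans to ≤-trans
             ; antisym to ≤-antisym; total to ≤-total )
  open Strict _≡_ _≤_ public using (_<_)

  commutativeRing : CommutativeRing 0ℓ 0ℓ
  commutativeRing = record { isCommutativeRing = isCommutativeRing }

  open CommutativeRing commutativeRing public
    using ( ring; +-comm; +-assoc; +-identityˡ; +-identityʳ; -‿inverseˡ; -‿inverseʳ
          ; *-comm; *-assoc; *-identityˡ; *-identityʳ; distribˡ; distribʳ; zeroˡ; zeroʳ )

  _-_ : ℝ → ℝ → ℝ
  x - y = x + - y
  infixl 6 _-_

  fromℕ : ℕ → ℝ
  fromℕ zero    = 0#
  fromℕ (suc n) = 1# + fromℕ n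

  _/_ : ℝ → ℕ → ℝ
  x / n = x * fromℕ n ⁻¹
  infixl 7 _/_

module SquareRoot (R : RealNumbers) where
  open RealNumbers R
  open RingProperties ring
  open ≡-Reasoning

  open import Algebra.Solver.Ring.NaturalCoefficients.Default
    (CommutativeRing.commutativeSemiring commutativeRing)

  ≰⇒≥ : ∀ {x y} → ¬ x ≤ y → y ≤ x
  ≰⇒≥ {x} {y} x≰y with ≤-total x y
  ... | inj₁ x≤y = ⊥-elim (x≰y x≤y)
  ... | inj₂ y≤x = y≤x

  difference : ∀ {x y} → x ≤ y → ∃[ e ] 0# ≤ e × x + e ≡ y
  difference {x} {y} x≤y = - x + y
    , subst (_≤ - x + y) (-‿inverseˡ x) (+-monoʳ-≤ (- x) x≤y)
    , trans (sym (+-assoc x (- x) y)) (trans (cong (_+ y) (-‿inverseʳ x)) (+-identityˡ y))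

  x≤x+e : ∀ x {e} → 0# ≤ e → x ≤ x + e
  x≤x+e x 0≤e = subst (_≤ x + _) (+-identityʳ x) (+-monoʳ-≤ x 0≤e)

  +-nonneg : ∀ {x y} → 0# ≤ x → 0# ≤ y → 0# ≤ x + y
  +-nonneg 0≤x 0≤y = ≤-trans 0≤x (x≤x+e _ 0≤y)

  *-monoˡ-≤ : ∀ {x y z} → 0# ≤ z → x ≤ y → x * z ≤ y * z
  *-monoˡ-≤ {x} {y} {z} 0≤z x≤y with difference x≤y
  ... | e , 0≤e , refl = subst (x * z ≤_) (sym (distribʳ z x e)) (x≤x+e _ (*-nonneg 0≤e 0≤z))

  square-mono-≤ : ∀ {x y} → 0# ≤ x → x ≤ y → x * x ≤ y * y
  square-mono-≤ {x} {y} 0≤x x≤y =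
    ≤-trans (*-monoˡ-≤ 0≤x x≤y)
            (subst (_≤ y * y) (*-comm x y) (*-monoˡ-≤ (≤-trans 0≤x x≤y) x≤y))

  square-neg : ∀ x → - x * - x ≡ x * x
  square-neg x = begin
    - x * - x     ≡⟨ -‿distribˡ-* x (- x) ⟨
    - (x * - x)   ≡⟨ cong -_ (-‿distribʳ-* x x) ⟨
    - - (x * x)   ≡⟨ -‿involutive (x * x) ⟩
    x * x         ∎

  square-nonneg : ∀ x → 0# ≤ x * x
  square-nonneg x with ≤-total 0# x
  ... | inj₁ 0≤x = *-nonneg 0≤x 0≤x
  ... | inj₂ x≤0 with difference x≤0
  ...   | e , 0≤e , x+e≡0 = subst (0# ≤_) (trans (cong₂ _*_ e≡-x e≡-x) (square-neg x)) (*-nonneg 0≤e 0≤e)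
    where
    e≡-x : e ≡ - x
    e≡-x = begin
      e               ≡⟨ +-identityˡ e ⟨
      0# + e          ≡⟨ cong (_+ e) (-‿inverseˡ x) ⟨
      - x + x + e     ≡⟨ +-assoc (- x) x e ⟩
      - x + (x + e)   ≡⟨ cong (- x +_) x+e≡0 ⟩
      - x + 0#        ≡⟨ +-identityʳ (- x) ⟩
      - x             ∎

  0≤1 : 0# ≤ 1#
  0≤1 = subst (0# ≤_) (*-identityˡ 1#) (square-nonneg 1#)

  *-cancelˡ : ∀ {x y z} → x ≢ 0# → x * y ≡ x * z → y ≡ z
  *-cancelˡ {x} {y} {z} x≢0 eq = begin
    y                 ≡⟨ lemma y ⟨
    x ⁻¹ * (x * y)    ≡⟨ cong (x ⁻¹ *_) eq ⟩
    x ⁻¹ * (x * z)    ≡⟨ lemma z ⟩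
    z                 ∎
    where
    lemma : ∀ w → x ⁻¹ * (x * w) ≡ w
    lemma w = begin
      x ⁻¹ * (x * w)  ≡⟨ *-assoc (x ⁻¹) x w ⟨
      x ⁻¹ * x * w    ≡⟨ cong (_* w) (trans (*-comm (x ⁻¹) x) (*-inverseʳ x≢0)) ⟩
      1# * w          ≡⟨ *-identityˡ w ⟩
      w               ∎

  *-≢0 : ∀ {x y} → x ≢ 0# → y ≢ 0# → x * y ≢ 0#
  *-≢0 {x} x≢0 y≢0 xy≡0 = y≢0 (*-cancelˡ x≢0 (trans xy≡0 (sym (zeroʳ x))))

  +-≡0 : ∀ {x y} → 0# ≤ x → 0# ≤ y → x + y ≡ 0# → x ≡ 0#
  +-≡0 {x} {y} 0≤x 0≤y eq = ≤-antisym (subst (x ≤_) eq (x≤x+e x 0≤y)) 0≤x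

  private
    sqrt′ : ∀ a → 0# ≤ a → ∃[ s ] 0# ≤ s × s * s ≡ a
    sqrt′ a 0≤a = s , 0≤s , ≤-antisym (≮⇒≥ a≮s²) (≮⇒≥ s²≮a)
      where
      A : Pred ℝ 0ℓ
      A y = y * y ≤ a

      0≤1+a : 0# ≤ 1# + a
      0≤1+a = +-nonneg 0≤1 0≤a

      0≤d : 0# ≤ 1# + (a + a * a)
      0≤d = +-nonneg 0≤1 (+-nonneg 0≤a (*-nonneg 0≤a 0≤a))

      k = 1# + a
      d = 1# + (a + a * a)

      k²≡a+d : k * k ≡ a + d
      k²≡a+d = identity a
        where
        identity : ∀ a → (1# + a) * (1# + a) ≡ a + (1# + (a + a * a))
        identity = solve 1 (λ a → (con 1 :+ a) :* (con 1 :+ a) := a :+ (con 1 :+ (a :+ a :* a))) refl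

      d≢0 : d ≢ 0#
      d≢0 d≡0 = 1≢0 (+-≡0 0≤1 (+-nonneg 0≤a (*-nonneg 0≤a 0≤a)) d≡0)

      k-bound : UpperBound A k
      k-bound {y} y²≤a with y ≤? k
      ... | yes y≤k = y≤k
      ... | no  y≰k = ⊥-elim (d≢0 (≤-antisym d≤0 0≤d))
        where
        a+d≤a : a + d ≤ a
        a+d≤a = subst (_≤ a) k²≡a+d (≤-trans (square-mono-≤ 0≤1+a (≰⇒≥ y≰k)) y²≤a)
        d≤0 : d ≤ 0#
        d≤0 = subst₂ _≤_ (trans (sym (+-assoc (- a) a d)) (trans (cong (_+ d) (-‿inverseˡ a)) (+-identityˡ d)))
                         (-‿inverseˡ a) (+-monoʳ-≤ (- a) a+d≤a)

      sup = supremum A (0# , subst (_≤ a) (sym (zeroˡ 0#)) 0≤a) (k , k-bound)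
      s = proj₁ sup

      s-bound : UpperBound A s
      s-bound = proj₁ (proj₂ sup)

      s-least : ∀ {u} → UpperBound A u → s ≤ u
      s-least = proj₂ (proj₂ sup)

      0≤s : 0# ≤ s
      0≤s = s-bound (subst (_≤ a) (sym (zeroˡ 0#)) 0≤a)

      D = s + k

      0≤D : 0# ≤ D
      0≤D = +-nonneg 0≤s 0≤1+a

      D≢0 : D ≢ 0#
      D≢0 D≡0 = 1≢0 (+-≡0 0≤1 (+-nonneg 0≤a 0≤s) (trans (identity s a) D≡0))
        where
        identity : ∀ s a → 1# + (a + s) ≡ s + (1# + a)
        identity = solve 2 (λ s a → con 1 :+ (a :+ s) := s :+ (con 1 :+ a)) refl

      D²≢0 : D * D ≢ 0#
      D²≢0 = *-≢0 D≢0 D≢0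

      cancel-≤ : ∀ {x y} → x * D ≤ y * D → x ≤ y
      cancel-≤ {x} {y} xD≤yD with x ≤? y
      ... | yes x≤y = x≤y
      ... | no  x≰y = ≤-reflexive (*-cancelˡ D≢0 (trans (*-comm D x) (trans xD≡yD (*-comm y D))))
        where
        xD≡yD : x * D ≡ y * D
        xD≡yD = ≤-antisym xD≤yD (*-monoˡ-≤ 0≤D (≰⇒≥ x≰y))

      q = (s * k + a) * D ⁻¹

      qD : q * D ≡ s * k + a
      qD = begin
        (s * k + a) * D ⁻¹ * D    ≡⟨ *-assoc (s * k + a) (D ⁻¹) D ⟩
        (s * k + a) * (D ⁻¹ * D)  ≡⟨ cong ((s * k + a) *_) (trans (*-comm (D ⁻¹) D) (*-inverseʳ D≢0)) ⟩
        (s * k + a) * 1#          ≡⟨ *-identityʳ (s * k + a) ⟩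
        s * k + a                 ∎

      q²D² : q * q * D * D ≡ (s * k + a) * (s * k + a)
      q²D² = trans (identity q D) (cong₂ _*_ qD qD)
        where
        identity : ∀ q D → q * q * D * D ≡ (q * D) * (q * D)
        identity = solve 2 (λ q D → q :* q :* D :* D := (q :* D) :* (q :* D)) refl

      0≤q : 0# ≤ q
      0≤q = cancel-≤ (subst₂ _≤_ (sym (zeroˡ D)) (sym qD) (+-nonneg (*-nonneg 0≤s 0≤1+a) 0≤a))

      expand : (s * k + a) * (s * k + a) ≡ s * s * (a + d) + ((s * k + s * k) * a + a * a)
      expand = trans (identity s k a) (cong (λ w → s * s * w + ((s * k + s * k) * a + a * a)) k²≡a+d)
        where
        identity : ∀ s k a → (s * k + a) * (s * k + a) ≡ s * s * (k * k) + ((s * k + s * k) * a + a * a)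
        identity = solve 3 (λ s k a → (s :* k :+ a) :* (s :* k :+ a) := s :* s :* (k :* k) :+ ((s :* k :+ s :* k) :* a :+ a :* a)) refl

      collect : s * s * a + a * d + ((s * k + s * k) * a + a * a) ≡ a * D * D
      collect = trans (identity₁ s k a d)
                      (trans (cong (λ w → s * s * a + (s * k + s * k) * a + a * w) (sym k²≡a+d)) (identity₂ s k a))
        where
        identity₁ : ∀ s k a d → s * s * a + a * d + ((s * k + s * k) * a + a * a)
                              ≡ s * s * a + (s * k + s * k) * a + a * (a + d)
        identity₁ = solve 4 (λ s k a d → s :* s :* a :+ a :* d :+ ((s :* k :+ s :* k) :* a :+ a :* a) := s :* s :* a :+ (s :* k :+ s :* k) :* a :+ a :* (a :+ d)) refl
        identity₂ : ∀ s k a → s * s * a + (s * k + s * k) * a + a * (k * k) ≡ a * (s + k) * (s + k)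
        identity₂ = solve 3 (λ s k a → s :* s :* a :+ (s :* k :+ s :* k) :* a :+ a :* (k :* k) := a :* (s :+ k) :* (s :+ k)) refl

      s²≮a : ¬ (s * s ≤ a × s * s ≢ a)
      s²≮a (s²≤a , s²≢a) with difference s²≤a
      ... | e , 0≤e , s²+e≡a = s²≢a (trans (cong (s *_) (≤-antisym s≤q q≤s)) sq≡a)
        where
        eqn : q * q * D * D + e * d ≡ a * D * D
        eqn = begin
          q * q * D * D + e * d                                          ≡⟨ cong (_+ e * d) (trans q²D² expand) ⟩
          s * s * (a + d) + ((s * k + s * k) * a + a * a) + e * d        ≡⟨ identity (s * s) a d e ((s * k + s * k) * a + a * a) ⟩
          s * s * a + (s * s + e) * d + ((s * k + s * k) * a + a * a)    ≡⟨ cong (λ w → s * s * a + w * d + ((s * k + s * k) * a + a * a)) s²+e≡a ⟩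
          s * s * a + a * d + ((s * k + s * k) * a + a * a)              ≡⟨ collect ⟩
          a * D * D                                                      ∎
          where
          identity : ∀ t a d e x → t * (a + d) + x + e * d ≡ t * a + (t + e) * d + x
          identity = solve 5 (λ t a d e x → t :* (a :+ d) :+ x :+ e :* d := t :* a :+ (t :+ e) :* d :+ x) refl
        q²≤a : q * q ≤ a
        q²≤a = cancel-≤ (cancel-≤ (subst (q * q * D * D ≤_) eqn (x≤x+e _ (*-nonneg 0≤e 0≤d))))
        q≤s : q ≤ s
        q≤s = s-bound q²≤a
        sD≤qD : s * D + e ≡ q * D
        sD≤qD = begin
          s * (s + k) + e       ≡⟨ identity s k e ⟩
          s * k + (s * s + e)   ≡⟨ cong (s * k +_) s²+e≡a ⟩
          s * k + a             ≡⟨ qD ⟨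
          q * D                 ∎
          where
          identity : ∀ s k e → s * (s + k) + e ≡ s * k + (s * s + e)
          identity = solve 3 (λ s k e → s :* (s :+ k) :+ e := s :* k :+ (s :* s :+ e)) refl
        s≤q : s ≤ q
        s≤q = cancel-≤ (subst (s * D ≤_) sD≤qD (x≤x+e _ 0≤e))
        sq≡a : s * q ≡ a
        sq≡a = +-cancelˡ (s * k) _ _ (begin
          s * k + s * q   ≡⟨ cong (λ w → s * k + s * w) (≤-antisym q≤s s≤q) ⟩
          s * k + s * s   ≡⟨ identity s k ⟩
          s * D           ≡⟨ cong (_* D) (≤-antisym s≤q q≤s) ⟩
          q * D           ≡⟨ qD ⟩
          s * k + a       ∎)
          where
          identity : ∀ s k → s * k + s * s ≡ s * (s + k)
          identity = solve 2 (λ s k → s :* k :+ s :* s := s :* (s :+ k)) refl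

      a≮s² : ¬ (a ≤ s * s × a ≢ s * s)
      a≮s² (a≤s² , a≢s²) with difference a≤s²
      ... | e , 0≤e , a+e≡s² = a≢s² (sym s²≡a)
        where
        eqn : q * q * D * D ≡ a * D * D + e * d
        eqn = begin
          q * q * D * D                                                  ≡⟨ trans q²D² expand ⟩
          s * s * (a + d) + ((s * k + s * k) * a + a * a)                ≡⟨ identity₁ (s * s) a d ((s * k + s * k) * a + a * a) ⟩
          s * s * a + s * s * d + ((s * k + s * k) * a + a * a)          ≡⟨ cong (λ w → s * s * a + w * d + ((s * k + s * k) * a + a * a)) a+e≡s² ⟨
          s * s * a + (a + e) * d + ((s * k + s * k) * a + a * a)        ≡⟨ identity₂ (s * s) a d e ((s * k + s * k) * a + a * a) ⟩
          s * s * a + a * d + ((s * k + s * k) * a + a * a) + e * d      ≡⟨ cong (_+ e * d) collect ⟩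
          a * D * D + e * d                                              ∎
          where
          identity₁ : ∀ t a d x → t * (a + d) + x ≡ t * a + t * d + x
          identity₁ = solve 4 (λ t a d x → t :* (a :+ d) :+ x := t :* a :+ t :* d :+ x) refl
          identity₂ : ∀ t a d e x → t * a + (a + e) * d + x ≡ t * a + a * d + x + e * d
          identity₂ = solve 5 (λ t a d e x → t :* a :+ (a :+ e) :* d :+ x := t :* a :+ a :* d :+ x :+ e :* d) refl
        a≤q² : a ≤ q * q
        a≤q² = cancel-≤ (cancel-≤ (subst (a * D * D ≤_) (sym eqn) (x≤x+e _ (*-nonneg 0≤e 0≤d))))
        q-bound : UpperBound A q
        q-bound {y} y²≤a with y ≤? q
        ... | yes y≤q = y≤q
        ... | no  y≰q = ⊥-elim (a≢s² (trans (sym (+-identityʳ a)) (trans (cong (a +_) (sym e≡0)) a+e≡s²)))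
          where
          q²≡a : q * q ≡ a
          q²≡a = ≤-antisym (≤-trans (square-mono-≤ 0≤q (≰⇒≥ y≰q)) y²≤a) a≤q²
          ed≡0 : 0# ≡ e * d
          ed≡0 = +-cancelˡ (a * D * D) _ _
                   (trans (+-identityʳ _) (trans (cong (λ w → w * D * D) (sym q²≡a)) eqn))
          e≡0 : e ≡ 0#
          e≡0 = *-cancelˡ d≢0 (trans (*-comm d e) (trans (sym ed≡0) (sym (zeroʳ d))))
        sD≡qD+e : q * D + e ≡ s * D
        sD≡qD+e = begin
          q * D + e             ≡⟨ cong (_+ e) qD ⟩
          s * k + a + e         ≡⟨ +-assoc (s * k) a e ⟩
          s * k + (a + e)       ≡⟨ cong (s * k +_) a+e≡s² ⟩
          s * k + s * s         ≡⟨ identity s k ⟩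
          s * D                 ∎
          where
          identity : ∀ s k → s * k + s * s ≡ s * (s + k)
          identity = solve 2 (λ s k → s :* k :+ s :* s := s :* (s :+ k)) refl
        s≡q : s ≡ q
        s≡q = ≤-antisym (s-least q-bound) (cancel-≤ (subst (q * D ≤_) sD≡qD+e (x≤x+e _ 0≤e)))
        s²≡a : s * s ≡ a
        s²≡a = +-cancelˡ (s * k) _ _ (begin
          s * k + s * s   ≡⟨ identity s k ⟩
          s * D           ≡⟨ cong (_* D) s≡q ⟩
          q * D           ≡⟨ qD ⟩
          s * k + a       ∎)
          where
          identity : ∀ s k → s * k + s * s ≡ s * (s + k)
          identity = solve 2 (λ s k → s :* k :+ s :* s := s :* (s :+ k)) refl

      ≮⇒≥ : ∀ {x y} → ¬ (y ≤ x × y ≢ x) → x ≤ y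
      ≮⇒≥ {x} {y} ¬y<x with ≤-total x y | y ≟ x
      ... | inj₁ x≤y | _        = x≤y
      ... | inj₂ y≤x | yes y≡x  = ≤-reflexive (sym y≡x)
      ... | inj₂ y≤x | no  y≢x  = ⊥-elim (¬y<x (y≤x , y≢x))

  abstract
    sqrt : ∀ a → 0# ≤ a → ∃[ s ] 0# ≤ s × s * s ≡ a
    sqrt = sqrt′

module Complex (R : RealNumbers) where
  open RealNumbers R
  open SquareRoot R
  open RingProperties ring

  infix  8 -ℂ_
  infixl 7 _*ℂ_ _•_
  infixl 6 _+ℂ_ _-ℂ_

  record ℂ : Set where
    constructor complex
    field
      re im : ℝ

  open ℂ public

  ofℝ : ℝ → ℂ
  ofℝ x = complex x 0#

  i·_ : ℝ → ℂ
  i· x = complex 0# x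

  0ℂ 1ℂ : ℂ
  0ℂ = ofℝ 0#
  1ℂ = ofℝ 1#

  _+ℂ_ _*ℂ_ _-ℂ_ : ℂ → ℂ → ℂ
  complex a b +ℂ complex c d = complex (a + c) (b + d)
  complex a b *ℂ complex c d = complex (a * c - b * d) (a * d + b * c)
  complex a b -ℂ complex c d = complex (a - c) (b - d)

  -ℂ_ : ℂ → ℂ
  -ℂ complex a b = complex (- a) (- b)

  _•_ : ℝ → ℂ → ℂ
  r • complex a b = complex (r * a) (r * b)

  1ℂ≢0ℂ : 1ℂ ≢ 0ℂ
  1ℂ≢0ℂ eq = 1≢0 (cong re eq)

  _≟ℂ_ : (z w : ℂ) → Dec (z ≡ w)
  complex a b ≟ℂ complex c d =
    map′ (λ (a≡c , b≡d) → cong₂ complex a≡c b≡d) (λ eq → cong re eq , cong im eq) (a ≟ c ×-dec b ≟ d)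

  ∣_∣² : ℂ → ℝ
  ∣ complex a b ∣² = a * a + b * b

  ∣∣²-nonneg : ∀ z → 0# ≤ ∣ z ∣²
  ∣∣²-nonneg (complex a b) = +-nonneg (square-nonneg a) (square-nonneg b)

  ∣_∣ : ℂ → ℝ
  ∣ z ∣ = proj₁ (sqrt ∣ z ∣² (∣∣²-nonneg z))

  ∣∣-nonneg : ∀ z → 0# ≤ ∣ z ∣
  ∣∣-nonneg z = proj₁ (proj₂ (sqrt ∣ z ∣² (∣∣²-nonneg z)))

  ∣∣*∣∣ : ∀ z → ∣ z ∣ * ∣ z ∣ ≡ ∣ z ∣²
  ∣∣*∣∣ z = proj₂ (proj₂ (sqrt ∣ z ∣² (∣∣²-nonneg z)))

  normalize : ℂ → ℂ
  normalize z = ∣ z ∣ ⁻¹ • z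

  ℂ-hyperfield : RawHyperfield
  ℂ-hyperfield = record
    { Carrier = ℂ
    ; 0#      = 0ℂ
    ; 1#      = 1ℂ
    ; -_      = -ℂ_
    ; _*_     = _*ℂ_
    ; _⊞_     = λ x y → ｛ x +ℂ y ｝
    ; 1≢0     = 1ℂ≢0ℂ
    }

  module ModulusProperties where
    open import Algebra.Solver.Ring.NaturalCoefficients.Default
      (CommutativeRing.commutativeSemiring commutativeRing)
    open ≡-Reasoning

    ∣1∣²≡1 : ∣ 1ℂ ∣² ≡ 1#
    ∣1∣²≡1 = solve 0 (con 1 :* con 1 :+ con 0 :* con 0 := con 1) refl

    ∣0∣²≡0 : ∣ 0ℂ ∣² ≡ 0#
    ∣0∣²≡0 = trans (cong₂ _+_ (zeroˡ 0#) (zeroˡ 0#)) (+-identityˡ 0#)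

    ∣-∣² : ∀ z → ∣ -ℂ z ∣² ≡ ∣ z ∣²
    ∣-∣² (complex a b) = cong₂ _+_ (square-neg a) (square-neg b)

    ∣•∣² : ∀ r z → ∣ r • z ∣² ≡ r * r * ∣ z ∣²
    ∣•∣² r (complex a b) = identity r a b
      where
      identity : ∀ r a b → (r * a) * (r * a) + (r * b) * (r * b) ≡ r * r * (a * a + b * b)
      identity = solve 3 (λ r a b → (r :* a) :* (r :* a) :+ (r :* b) :* (r :* b)
                                 := r :* r :* (a :* a :+ b :* b)) refl

    ∣*∣² : ∀ z w → ∣ z *ℂ w ∣² ≡ ∣ z ∣² * ∣ w ∣²
    ∣*∣² (complex a b) (complex c d) = begin
      (a * c - b * d) * (a * c - b * d) + (a * d + b * c) * (a * d + b * c)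
        ≡⟨ cong (λ w → (a * c + w) * (a * c + w) + (a * d + b * c) * (a * d + b * c)) (-‿distribˡ-* b d) ⟩
      (a * c + - b * d) * (a * c + - b * d) + (a * d + b * c) * (a * d + b * c)
        ≡⟨ identity₁ a b c d (- b) ⟩
      (- b + b) * x + (a * a * (c * c + d * d) + (b * b * (c * c) + (- b * - b) * (d * d)))
        ≡⟨ cong₂ (λ u v → u * x + (a * a * (c * c + d * d) + (b * b * (c * c) + v * (d * d))))
                 (-‿inverseˡ b) (square-neg b) ⟩
      0# * x + (a * a * (c * c + d * d) + (b * b * (c * c) + b * b * (d * d)))
        ≡⟨ identity₂ a b c d x ⟩
      (a * a + b * b) * (c * c + d * d) ∎
      where
      x = a * c * d + a * c * d
      identity₁ : ∀ a b c d b′ →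
        (a * c + b′ * d) * (a * c + b′ * d) + (a * d + b * c) * (a * d + b * c) ≡
        (b′ + b) * (a * c * d + a * c * d) + (a * a * (c * c + d * d) + (b * b * (c * c) + (b′ * b′) * (d * d)))
      identity₁ = solve 5 (λ a b c d b′ →
        (a :* c :+ b′ :* d) :* (a :* c :+ b′ :* d) :+ (a :* d :+ b :* c) :* (a :* d :+ b :* c) :=
        (b′ :+ b) :* (a :* c :* d :+ a :* c :* d) :+ (a :* a :* (c :* c :+ d :* d) :+ (b :* b :* (c :* c) :+ (b′ :* b′) :* (d :* d)))) refl
      identity₂ : ∀ a b c d x →
        0# * x + (a * a * (c * c + d * d) + (b * b * (c * c) + b * b * (d * d))) ≡ (a * a + b * b) * (c * c + d * d)
      identity₂ = solve 5 (λ a b c d x →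
        con 0 :* x :+ (a :* a :* (c :* c :+ d :* d) :+ (b :* b :* (c :* c) :+ b :* b :* (d :* d)))
        := (a :* a :+ b :* b) :* (c :* c :+ d :* d)) refl

    ∣∣≡1⇒∣∣²≡1 : ∀ z → ∣ z ∣ ≡ 1# → ∣ z ∣² ≡ 1#
    ∣∣≡1⇒∣∣²≡1 z eq = trans (sym (∣∣*∣∣ z)) (trans (cong₂ _*_ eq eq) (*-identityˡ 1#))

    ∣∣²≡1⇒∣∣≡1 : ∀ z → ∣ z ∣² ≡ 1# → ∣ z ∣ ≡ 1#
    ∣∣²≡1⇒∣∣≡1 z eq with ≤-total 1# ∣ z ∣
    ... | inj₁ 1≤s = ≤-antisym (subst₂ _≤_ (*-identityˡ _) (trans (∣∣*∣∣ z) eq) (*-monoˡ-≤ (∣∣-nonneg z) 1≤s)) 1≤s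
    ... | inj₂ s≤1 = ≤-antisym s≤1 (subst₂ _≤_ (trans (∣∣*∣∣ z) eq) (*-identityˡ _) (*-monoˡ-≤ (∣∣-nonneg z) s≤1))

    ∣∣²≡0⇒≡0 : ∀ z → ∣ z ∣² ≡ 0# → z ≡ 0ℂ
    ∣∣²≡0⇒≡0 (complex a b) eq = cong₂ complex
      (square≡0 a (+-≡0 (square-nonneg a) (square-nonneg b) eq))
      (square≡0 b (+-≡0 (square-nonneg b) (square-nonneg a) (trans (+-comm (b * b) (a * a)) eq)))
      where
      square≡0 : ∀ x → x * x ≡ 0# → x ≡ 0#
      square≡0 x x²≡0 with x ≟ 0#
      ... | yes x≡0 = x≡0
      ... | no  x≢0 = ⊥-elim (*-≢0 x≢0 x≢0 x²≡0)

    ∣normalize∣≡1 : ∀ z → z ≢ 0ℂ → ∣ normalize z ∣ ≡ 1#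
    ∣normalize∣≡1 z z≢0 = ∣∣²≡1⇒∣∣≡1 (normalize z) (begin
      ∣ normalize z ∣²                            ≡⟨ ∣•∣² (∣ z ∣ ⁻¹) z ⟩
      ∣ z ∣ ⁻¹ * ∣ z ∣ ⁻¹ * ∣ z ∣²                ≡⟨ cong (∣ z ∣ ⁻¹ * ∣ z ∣ ⁻¹ *_) (∣∣*∣∣ z) ⟨
      ∣ z ∣ ⁻¹ * ∣ z ∣ ⁻¹ * (∣ z ∣ * ∣ z ∣)       ≡⟨ identity (∣ z ∣) (∣ z ∣ ⁻¹) ⟩
      (∣ z ∣ * ∣ z ∣ ⁻¹) * (∣ z ∣ * ∣ z ∣ ⁻¹)     ≡⟨ cong₂ _*_ inverse inverse ⟩
      1# * 1#                                     ≡⟨ *-identityˡ 1# ⟩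
      1#                                          ∎)
      where
      identity : ∀ s t → t * t * (s * s) ≡ (s * t) * (s * t)
      identity = solve 2 (λ s t → t :* t :* (s :* s) := (s :* t) :* (s :* t)) refl
      inverse : ∣ z ∣ * ∣ z ∣ ⁻¹ ≡ 1#
      inverse = *-inverseʳ λ s≡0 → z≢0 (∣∣²≡0⇒≡0 z
        (trans (sym (∣∣*∣∣ z)) (trans (cong (_* ∣ z ∣) s≡0) (zeroˡ ∣ z ∣))))

  open ModulusProperties

  IsPhase : ℂ → Set
  IsPhase z = z ≡ 0ℂ ⊎ ∣ z ∣ ≡ 1#

  record Phase : Set where
    constructor phase
    field
      value    : ℂ
      .isPhase : IsPhase value

  open Phase public

  0ℙ 1ℙ : Phase
  0ℙ = phase 0ℂ (inj₁ refl)
  1ℙ = phase 1ℂ (inj₂ (∣∣²≡1⇒∣∣≡1 1ℂ ∣1∣²≡1))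

  -ℙ_ : Phase → Phase
  -ℙ phase z h = phase (-ℂ z) (neg h)
    where
    neg : IsPhase z → IsPhase (-ℂ z)
    neg (inj₁ refl) = inj₁ (cong₂ complex -0#≈0# -0#≈0#)
    neg (inj₂ h)    = inj₂ (∣∣²≡1⇒∣∣≡1 (-ℂ z) (trans (∣-∣² z) (∣∣≡1⇒∣∣²≡1 z h)))

  _*ℙ_ : Phase → Phase → Phase
  phase z hz *ℙ phase w hw = phase (z *ℂ w) (mul hz hw)
    where
    mul : IsPhase z → IsPhase w → IsPhase (z *ℂ w)
    mul (inj₁ z≡0) _ = inj₁ (∣∣²≡0⇒≡0 _ (trans (∣*∣² z w)
      (trans (cong (_* ∣ w ∣²) (trans (cong ∣_∣² z≡0) ∣0∣²≡0)) (zeroˡ ∣ w ∣²))))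
    mul (inj₂ hz) (inj₁ w≡0) = inj₁ (∣∣²≡0⇒≡0 _ (trans (∣*∣² z w)
      (trans (cong (∣ z ∣² *_) (trans (cong ∣_∣² w≡0) ∣0∣²≡0)) (zeroʳ ∣ z ∣²))))
    mul (inj₂ hz) (inj₂ hw) = inj₂ (∣∣²≡1⇒∣∣≡1 _ (trans (∣*∣² z w)
      (trans (cong₂ _*_ (∣∣≡1⇒∣∣²≡1 z hz) (∣∣≡1⇒∣∣²≡1 w hw)) (*-identityˡ 1#))))

  data _⊞ℙ_ (x y : Phase) : Pred Phase 0ℓ where
    zero+    : x ≡ 0ℙ → (x ⊞ℙ y) y
    +zero    : y ≡ 0ℙ → (x ⊞ℙ y) x
    opposite : ∀ {z} → y ≡ -ℙ x → z ≡ 0ℙ ⊎ z ≡ x ⊎ z ≡ -ℙ x → (x ⊞ℙ y) z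
    arc      : ∀ {z} α β → x ≢ 0ℙ → y ≢ 0ℙ → y ≢ -ℙ x → 0# < α → 0# < β →
               value z ≡ normalize (α • value x +ℂ β • value y) → (x ⊞ℙ y) z

  ℙ : RawHyperfield
  ℙ = record
    { Carrier = Phase
    ; 0#      = 0ℙ
    ; 1#      = 1ℙ
    ; -_      = -ℙ_
    ; _*_     = _*ℙ_
    ; _⊞_     = _⊞ℙ_
    ; 1≢0     = λ eq → 1ℂ≢0ℂ (cong value eq)
    }

  toPhase : ℂ → Phase
  toPhase z with z ≟ℂ 0ℂ
  ... | yes _   = 0ℙ
  ... | no  z≢0 = phase (normalize z) (inj₂ (∣normalize∣≡1 z z≢0))

  ConvergesTo : (ℕ → ℂ) → ℂ → Set
  ConvergesTo s z = ∀ ε → 0# < ε → ∃[ N ] ∀ n → N ℕ.≤ n → ∣ s n -ℂ z ∣ < ε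

  -- Euler's description of exp z as the limit of (1 + z/n)ⁿ, indexed from n = 1.

  IsExponential : (ℂ → ℂ) → Set
  IsExponential exp =
    ∀ z → ConvergesTo (λ n → (1ℂ +ℂ fromℕ (suc n) ⁻¹ • z) ^ suc n) (exp z)
    where open RawHyperfield ℂ-hyperfield using (_^_)

  -- π is the least positive zero of the sine function t ↦ Im exp (i t).

  IsPi : (ℂ → ℂ) → ℝ → Set
  IsPi exp π = 0# < π × sin π ≡ 0# × (∀ t → 0# < t → t < π → sin t ≢ 0#)
    where
    sin : ℝ → ℝ
    sin t = im (exp (i· t))

{-# OPTIONS --safe #-}
module Submission where

-- Write u = e^{iπ/24} = a + b i.  The limit defining exp, taken along the
-- multiples of k, gives exp (k z) = (exp z)^k.  Moreover t ↦ sin t is Lipschitz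
-- and nonnegative on [0, 1], so by the intermediate value theorem it is positive
-- on (0, π).  Hence a, b > 0, e^{iπ/2} = i and e^{23iπ/24} = - a + b i =: w, and
-- nothing else about these phases matters.
--
-- Over ℙ one has p̄ ∈ (T + 1) ⊡ (T² + d T + w) for d = (u + i) / |u + i|, and
-- T² + d T + w ∈ (T + 1) ⊡ (T + w).  In every such chain of factorisations the
-- last factor is T + w, which does not vanish at -1, so the multiplicity is 2.
--
-- Over ℂ, two negative roots x, y (possibly equal) of a polynomial with these
-- phases would satisfy x² + y² = 0, so there is at most one, and it is simple.

open import Defs
open import Level using (0ℓ)
open import Axiom.ExcludedMiddle using (ExcludedMiddle)
open import Algebra.Bundles using (CommutativeRing)
import Algebra.Properties.Ring as RingProperties
import Algebra.Properties.Semiring.Exp as SemiringExp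
import Algebra.Properties.Semiring.Mult.TCOptimised as Mult
import Algebra.Solver.Ring
open import Algebra.Solver.Ring.AlmostCommutativeRing using (_-Raw-AlmostCommutative⟶_; fromCommutativeRing)
open import Data.Empty using (⊥; ⊥-elim)
open import Data.Fin using (Fin; zero; suc; #_)
open import Data.Integer.Base as ℤ using (ℤ; -[1+_]) renaming (+_ to pos)
import Data.Integer.Properties as ℤ
open import Data.List.Base using ([]; _∷_; map; foldr)
open import Data.List.Relation.Unary.All as All using (All; []; _∷_)
open import Data.List.Relation.Unary.AllPairs using ([]; _∷_)
open import Data.List.Relation.Unary.Any using (here)
open import Data.List.Relation.Unary.Unique.Propositional using (Unique)
open import Data.Maybe.Base as Maybe using (Maybe)
open import Data.Nat using (_>_)
open import Data.Nat.Base as ℕ using (ℕ; zero; suc; z≤n; s≤s)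
open import Data.Nat.ListAction using (sum)
import Data.Nat.Properties as ℕ
open import Data.Product using (_×_; _,_; ∃-syntax; proj₁; proj₂; map₁)
open import Data.Sum.Base using (_⊎_; inj₁; inj₂)
open import Function.Base using (_∘_)
open import Relation.Binary.PropositionalEquality
open import Relation.Nullary using (¬_; yes; no; recompute; _⊎-dec_)
open import Relation.Nullary.Decidable using (dec⇒maybe)
open import Relation.Unary using (Pred; _∈_)

-- Powers of one exponential replace the former. The latter is read off the hypotheses: u and
-- e^{iπ/2} are values of coefficients over ℙ with nonzero imaginary part, hence of modulus 1. Then
-- e^{iπ} = i² = -1, and w solves u w = e^{iπ}. The chain of factorisations has a forced end because
-- the extreme coefficients of a product are hypersums of a single term: each quotient by T + 1
-- keeps constant term w and leading coefficient 1, and only the middle coefficients can vary. Over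
-- ℂ the rigidity comes from dividing by T - x with x real: real and imaginary parts are divided
-- separately, yet the same moduli of c₂ and c₀ occur in both, which overdetermines the two roots.

-- A ring solver with subtraction, by integer coefficients.

module IntegerCoefficients (R : RealNumbers) where
  open RealNumbers R
  open RingProperties ring
  open Mult (CommutativeRing.semiring commutativeRing) renaming (_×_ to _ℕ·_)
  open ≡-Reasoning

  -- The canonical map from ℤ, built on the multiple for which one times x is x by computation; so
  -- `con (pos 1)` denotes `1#` literally and solver equations match their goals.
  ⟦_⟧ℤ : ℤ → ℝ
  ⟦ pos n ⟧ℤ      = n ℕ· 1#
  ⟦ -[1+ n ] ⟧ℤ = - (suc n ℕ· 1#)

  ⟦-⟧ : ∀ i → ⟦ ℤ.- i ⟧ℤ ≡ - ⟦ i ⟧ℤ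
  ⟦-⟧ (pos zero)  = sym -0#≈0#
  ⟦-⟧ (pos (suc n)) = refl
  ⟦-⟧ -[1+ n ]  = sym (-‿involutive _)

  +-cancel-common : ∀ x y z → (x + y) - (x + z) ≡ y - z
  +-cancel-common x y z = begin
    (x + y) + - (x + z)    ≡⟨ cong₂ _+_ (+-comm x y) (sym (-‿+-comm x z)) ⟩
    (y + x) + (- x + - z)  ≡⟨ +-assoc y x _ ⟩
    y + (x + (- x + - z))  ≡⟨ cong (y +_) (sym (+-assoc x (- x) (- z))) ⟩
    y + (x + - x + - z)    ≡⟨ cong (λ w → y + (w + - z)) (-‿inverseʳ x) ⟩
    y + (0# + - z)         ≡⟨ cong (y +_) (+-identityˡ (- z)) ⟩
    y + - z                ∎

  ⟦⊖⟧ : ∀ m n → ⟦ m ℤ.⊖ n ⟧ℤ ≡ m ℕ· 1# - n ℕ· 1#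
  ⟦⊖⟧ m       zero    = sym (trans (cong (m ℕ· 1# +_) -0#≈0#) (+-identityʳ _))
  ⟦⊖⟧ zero    (suc n) = sym (+-identityˡ _)
  ⟦⊖⟧ (suc m) (suc n) = begin
    ⟦ suc m ℤ.⊖ suc n ⟧ℤ             ≡⟨ cong ⟦_⟧ℤ (ℤ.[1+m]⊖[1+n]≡m⊖n m n) ⟩
    ⟦ m ℤ.⊖ n ⟧ℤ                     ≡⟨ ⟦⊖⟧ m n ⟩
    m ℕ· 1# - n ℕ· 1#                  ≡⟨ +-cancel-common 1# (m ℕ· 1#) (n ℕ· 1#) ⟨
    (1# + m ℕ· 1#) - (1# + n ℕ· 1#)    ≡⟨ cong₂ _-_ (1+× m 1#) (1+× n 1#) ⟨
    suc m ℕ· 1# - suc n ℕ· 1#          ∎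

  ⟦+⟧ : ∀ i j → ⟦ i ℤ.+ j ⟧ℤ ≡ ⟦ i ⟧ℤ + ⟦ j ⟧ℤ
  ⟦+⟧ (pos m)    (pos n)    = ×-homo-+ 1# m n
  ⟦+⟧ (pos m)    -[1+ n ] = ⟦⊖⟧ m (suc n)
  ⟦+⟧ -[1+ m ] (pos n)    = trans (⟦⊖⟧ n (suc m)) (+-comm _ _)
  ⟦+⟧ -[1+ m ] -[1+ n ] = begin
    - (suc (suc (m ℕ.+ n)) ℕ· 1#)       ≡⟨ cong (λ k → - (k ℕ· 1#)) (sym (cong suc (ℕ.+-suc m n))) ⟩
    - ((suc m ℕ.+ suc n) ℕ· 1#)         ≡⟨ cong -_ (×-homo-+ 1# (suc m) (suc n)) ⟩
    - (suc m ℕ· 1# + suc n ℕ· 1#)        ≡⟨ -‿+-comm _ _ ⟨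
    - (suc m ℕ· 1#) + - (suc n ℕ· 1#)    ∎

  ⟦*⟧₊ : ∀ m j → ⟦ pos m ℤ.* j ⟧ℤ ≡ ⟦ pos m ⟧ℤ * ⟦ j ⟧ℤ
  ⟦*⟧₊ m (pos n)    = trans (cong ⟦_⟧ℤ (sym (ℤ.pos-* m n))) (×1-homo-* m n)
  ⟦*⟧₊ m -[1+ n ] = begin
    ⟦ pos m ℤ.* (ℤ.- (pos (suc n))) ⟧ℤ    ≡⟨ cong ⟦_⟧ℤ (ℤ.neg-distribʳ-* (pos m) (pos (suc n))) ⟨
    ⟦ ℤ.- (pos m ℤ.* pos (suc n)) ⟧ℤ      ≡⟨ ⟦-⟧ (pos m ℤ.* pos (suc n)) ⟩
    - ⟦ pos m ℤ.* pos (suc n) ⟧ℤ          ≡⟨ cong -_ (⟦*⟧₊ m (pos (suc n))) ⟩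
    - (m ℕ· 1# * suc n ℕ· 1#)         ≡⟨ -‿distribʳ-* _ _ ⟩
    m ℕ· 1# * - (suc n ℕ· 1#)         ∎

  ⟦*⟧ : ∀ i j → ⟦ i ℤ.* j ⟧ℤ ≡ ⟦ i ⟧ℤ * ⟦ j ⟧ℤ
  ⟦*⟧ (pos m)    j = ⟦*⟧₊ m j
  ⟦*⟧ -[1+ m ] j = begin
    ⟦ (ℤ.- (pos (suc m))) ℤ.* j ⟧ℤ    ≡⟨ cong ⟦_⟧ℤ (ℤ.neg-distribˡ-* (pos (suc m)) j) ⟨
    ⟦ ℤ.- (pos (suc m) ℤ.* j) ⟧ℤ      ≡⟨ ⟦-⟧ (pos (suc m) ℤ.* j) ⟩
    - ⟦ pos (suc m) ℤ.* j ⟧ℤ          ≡⟨ cong -_ (⟦*⟧₊ (suc m) j) ⟩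
    - (suc m ℕ· 1# * ⟦ j ⟧ℤ)       ≡⟨ -‿distribˡ-* _ _ ⟩
    - (suc m ℕ· 1#) * ⟦ j ⟧ℤ       ∎

  homomorphism : ℤ.+-*-rawRing -Raw-AlmostCommutative⟶ fromCommutativeRing commutativeRing
  homomorphism = record
    { ⟦_⟧    = ⟦_⟧ℤ
    ; +-homo = ⟦+⟧
    ; *-homo = ⟦*⟧
    ; -‿homo = ⟦-⟧
    ; 0-homo = refl
    ; 1-homo = refl
    }

  coefficient≟ : ∀ i j → Maybe (⟦ i ⟧ℤ ≡ ⟦ j ⟧ℤ)
  coefficient≟ i j = Maybe.map (cong ⟦_⟧ℤ) (dec⇒maybe (i ℤ.≟ j))

  module Solver = Algebra.Solver.Ring ℤ.+-*-rawRing (fromCommutativeRing commutativeRing)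
                    homomorphism coefficient≟

-- Ordered-field arithmetic and two-sided bounds.

module OrderedField (R : RealNumbers) where
  open RealNumbers R
  open SquareRoot R
  open IntegerCoefficients R
  open Solver

  ≤-by : ∀ {x y e} → 0# ≤ e → y ≡ x + e → x ≤ y
  ≤-by 0≤e refl = x≤x+e _ 0≤e

  0≤y-x : ∀ {x y} → x ≤ y → 0# ≤ y - x
  0≤y-x {x} {y} x≤y = subst (_≤ y - x) (-‿inverseʳ x)
    (subst₂ _≤_ (+-comm (- x) x) (+-comm (- x) y) (+-monoʳ-≤ (- x) x≤y))

  0≤y-x⇒x≤y : ∀ {x y} → 0# ≤ y - x → x ≤ y
  0≤y-x⇒x≤y {x} {y} h = ≤-by h (solve 2 (λ x y → y := x :+ (y :- x)) refl x y)

  pos⇒≢0 : ∀ {x} → 0# < x → x ≢ 0#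
  pos⇒≢0 (_ , 0≢x) = 0≢x ∘ sym

  ≰⇒> : ∀ {x y} → ¬ x ≤ y → y < x
  ≰⇒> x≰y = ≰⇒≥ x≰y , λ { refl → x≰y ≤-refl }

  <⇒≱ : ∀ {x y} → x < y → ¬ y ≤ x
  <⇒≱ (x≤y , x≢y) y≤x = x≢y (≤-antisym x≤y y≤x)

  <-≤-trans : ∀ {x y z} → x < y → y ≤ z → x < z
  <-≤-trans (x≤y , x≢y) y≤z = ≤-trans x≤y y≤z , λ { refl → x≢y (≤-antisym x≤y y≤z) }

  ≤-<-trans : ∀ {x y z} → x ≤ y → y < z → x < z
  ≤-<-trans x≤y (y≤z , y≢z) = ≤-trans x≤y y≤z , λ { refl → y≢z (≤-antisym y≤z x≤y) }

  ≮⇒≥ : ∀ {x y} → ¬ x < y → y ≤ x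
  ≮⇒≥ {x} {y} x≮y with y ≤? x
  ... | yes y≤x = y≤x
  ... | no  y≰x = ⊥-elim (x≮y (≰⇒> y≰x))

  0<1 : 0# < 1#
  0<1 = 0≤1 , 1≢0 ∘ sym

  *-pos : ∀ {x y} → 0# < x → 0# < y → 0# < x * y
  *-pos 0<x 0<y = *-nonneg (proj₁ 0<x) (proj₁ 0<y) , *-≢0 (pos⇒≢0 0<x) (pos⇒≢0 0<y) ∘ sym

  +-pos : ∀ {x y} → 0# < x → 0# ≤ y → 0# < x + y
  +-pos 0<x 0≤y = <-≤-trans 0<x (x≤x+e _ 0≤y)

  0<y-x : ∀ {x y} → x < y → 0# < y - x
  0<y-x {x} {y} (x≤y , x≢y) = 0≤y-x x≤y , λ eq → x≢y
    (trans (sym (+-identityʳ x)) (trans (cong (x +_) eq) (solve 2 (λ x y → x :+ (y :- x) := y) refl x y)))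

  neg-nonneg : ∀ {x} → x ≤ 0# → 0# ≤ - x
  neg-nonneg {x} x≤0 = subst (0# ≤_) (+-identityˡ (- x)) (0≤y-x x≤0)

  neg-pos : ∀ {x} → x < 0# → 0# < - x
  neg-pos {x} x<0 = subst (0# <_) (+-identityˡ (- x)) (0<y-x x<0)

  *-cancel-nonneg : ∀ {x y} → 0# < x → 0# ≤ x * y → 0# ≤ y
  *-cancel-nonneg {x} {y} 0<x 0≤xy with 0# ≤? y
  ... | yes 0≤y = 0≤y
  ... | no  0≰y = ⊥-elim (<⇒≱ (*-pos 0<x (neg-pos (≰⇒> 0≰y)))
          (0≤y-x⇒x≤y (subst (0# ≤_) (solve 2 (λ x y → x :* y := con (pos 0) :- x :* (:- y)) refl x y) 0≤xy)))

  *-cancel-pos : ∀ {x y} → 0# < x → 0# < x * y → 0# < y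
  *-cancel-pos {x} 0<x 0<xy = *-cancel-nonneg 0<x (proj₁ 0<xy)
    , λ { refl → pos⇒≢0 0<xy (zeroʳ x) }

  ⁻¹-pos : ∀ {x} → 0# < x → 0# < x ⁻¹
  ⁻¹-pos 0<x = *-cancel-pos 0<x (subst (0# <_) (sym (*-inverseʳ (pos⇒≢0 0<x))) 0<1)

  *-inverseˡ : ∀ {x} → x ≢ 0# → x ⁻¹ * x ≡ 1#
  *-inverseˡ {x} x≢0 = trans (*-comm (x ⁻¹) x) (*-inverseʳ x≢0)

  fromℕ-nonneg : ∀ n → 0# ≤ fromℕ n
  fromℕ-nonneg zero    = ≤-refl
  fromℕ-nonneg (suc n) = +-nonneg 0≤1 (fromℕ-nonneg n)

  fromℕ-pos : ∀ n → 0# < fromℕ (suc n)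
  fromℕ-pos n = +-pos 0<1 (fromℕ-nonneg n)

  fromℕ-+ : ∀ m n → fromℕ (m ℕ.+ n) ≡ fromℕ m + fromℕ n
  fromℕ-+ zero    n = sym (+-identityˡ _)
  fromℕ-+ (suc m) n = trans (cong (1# +_) (fromℕ-+ m n)) (sym (+-assoc _ _ _))

  fromℕ-* : ∀ m n → fromℕ (m ℕ.* n) ≡ fromℕ m * fromℕ n
  fromℕ-* zero    n = sym (zeroˡ _)
  fromℕ-* (suc m) n = trans (fromℕ-+ n (m ℕ.* n)) (trans (cong (fromℕ n +_) (fromℕ-* m n))
    (solve 2 (λ m n → n :+ m :* n := (con (pos 1) :+ m) :* n) refl (fromℕ m) (fromℕ n)))

  0<2 : 0# < 1# + 1#
  0<2 = +-pos 0<1 0≤1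

  half : ∀ {ε} → 0# < ε → ∃[ δ ] 0# < δ × δ + δ ≡ ε
  half {ε} 0<ε = (1# + 1#) ⁻¹ * ε , *-pos (⁻¹-pos 0<2) 0<ε
    , trans (solve 2 (λ t e → t :* e :+ t :* e := t :* (con (pos 1) :+ con (pos 1)) :* e) refl ((1# + 1#) ⁻¹) ε)
            (trans (cong (_* ε) (*-inverseˡ (pos⇒≢0 0<2))) (*-identityˡ ε))

  0≤x+x⇒0≤x : ∀ {x} → 0# ≤ x + x → 0# ≤ x
  0≤x+x⇒0≤x {x} h = *-cancel-nonneg 0<2
    (subst (0# ≤_) (solve 1 (λ x → x :+ x := (con (pos 1) :+ con (pos 1)) :* x) refl x) h)

  -- The minimum of 1 and ε/K; the cap at 1 lets a quadratic error δ² be absorbed into a linear one.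
  shrink : ∀ {ε K} → 0# < ε → 0# < K → ∃[ δ ] 0# < δ × δ ≤ 1# × δ * K ≤ ε
  shrink {ε} {K} 0<ε 0<K with ε * K ⁻¹ ≤? 1#
  ... | yes small = ε * K ⁻¹ , *-pos 0<ε (⁻¹-pos 0<K) , small , ≤-reflexive εK⁻¹K≡ε
    where
    εK⁻¹K≡ε : ε * K ⁻¹ * K ≡ ε
    εK⁻¹K≡ε = trans (*-assoc _ _ _) (trans (cong (ε *_) (*-inverseˡ (pos⇒≢0 0<K))) (*-identityʳ ε))
  ... | no  large = 1# , 0<1 , ≤-refl
      , subst (1# * K ≤_) (trans (*-assoc _ _ _) (trans (cong (ε *_) (*-inverseˡ (pos⇒≢0 0<K))) (*-identityʳ ε)))
              (*-monoˡ-≤ (proj₁ 0<K) (≰⇒≥ large))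

  -- d ∈± e means |d| ≤ e.
  infix 4 _∈±_
  record _∈±_ (d e : ℝ) : Set where
    constructor bounds
    field
      upper : 0# ≤ e - d
      lower : 0# ≤ e + d

  open _∈±_ public

  ∈±-bound-nonneg : ∀ {d e} → d ∈± e → 0# ≤ e
  ∈±-bound-nonneg {d} {e} (bounds p q) = 0≤x+x⇒0≤x
    (subst (0# ≤_) (solve 2 (λ d e → (e :- d) :+ (e :+ d) := e :+ e) refl d e) (+-nonneg p q))

  ∈±-cong : ∀ {c d e} → c ≡ d → c ∈± e → d ∈± e
  ∈±-cong refl h = h

  ∈±-mono : ∀ {d e f} → e ≤ f → d ∈± e → d ∈± f
  ∈±-mono {d} {e} {f} e≤f (bounds p q) = bounds
      (subst (0# ≤_) (solve 3 (λ d e f → (f :- e) :+ (e :- d) := f :- d) refl d e f) (+-nonneg (0≤y-x e≤f) p))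
      (subst (0# ≤_) (solve 3 (λ d e f → (f :- e) :+ (e :+ d) := f :+ d) refl d e f) (+-nonneg (0≤y-x e≤f) q))

  ∈±-+ : ∀ {c d e f} → c ∈± e → d ∈± f → c + d ∈± e + f
  ∈±-+ {c} {d} {e} {f} (bounds p q) (bounds p′ q′) = bounds
      (subst (0# ≤_) (solve 4 (λ c d e f → (e :- c) :+ (f :- d) := (e :+ f) :- (c :+ d)) refl c d e f) (+-nonneg p p′))
      (subst (0# ≤_) (solve 4 (λ c d e f → (e :+ c) :+ (f :+ d) := (e :+ f) :+ (c :+ d)) refl c d e f) (+-nonneg q q′))

  ∈±-neg : ∀ {d e} → d ∈± e → - d ∈± e
  ∈±-neg {d} {e} (bounds p q) = bounds (subst (0# ≤_) (solve 2 (λ d e → e :+ d := e :- (:- d)) refl d e) q) p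

  ∈±-- : ∀ {c d e f} → c ∈± e → d ∈± f → c - d ∈± e + f
  ∈±-- p q = ∈±-+ p (∈±-neg q)

  -- Twice e f - c d is (e - c)(f + d) + (e + c)(f - d), and similarly for e f + c d, so no case
  -- distinction on signs arises.
  ∈±-* : ∀ {c d e f} → c ∈± e → d ∈± f → c * d ∈± e * f
  ∈±-* {c} {d} {e} {f} (bounds p q) (bounds p′ q′) = bounds
      (0≤x+x⇒0≤x (subst (0# ≤_) (solve 4 (λ c d e f →
        (e :- c) :* (f :+ d) :+ (e :+ c) :* (f :- d) := (e :* f :- c :* d) :+ (e :* f :- c :* d)) refl c d e f)
        (+-nonneg (*-nonneg p q′) (*-nonneg q p′))))
      (0≤x+x⇒0≤x (subst (0# ≤_) (solve 4 (λ c d e f →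
        (e :- c) :* (f :- d) :+ (e :+ c) :* (f :+ d) := (e :* f :+ c :* d) :+ (e :* f :+ c :* d)) refl c d e f)
        (+-nonneg (*-nonneg p p′) (*-nonneg q q′))))

  nonneg-∈± : ∀ {d} → 0# ≤ d → d ∈± d
  nonneg-∈± {d} 0≤d = bounds (≤-reflexive (sym (-‿inverseʳ d))) (+-nonneg 0≤d 0≤d)

  magnitude : ∀ d → ∃[ e ] 0# ≤ e × d ∈± e
  magnitude d with ≤-total 0# d
  ... | inj₁ 0≤d = d , 0≤d , nonneg-∈± 0≤d
  ... | inj₂ d≤0 = - d , neg-nonneg d≤0
    , subst (_∈± - d) (solve 1 (λ d → :- :- d := d) refl d) (∈±-neg (nonneg-∈± (neg-nonneg d≤0)))

  square-≤⇒∈± : ∀ {d e} → 0# ≤ e → d * d ≤ e * e → d ∈± e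
  square-≤⇒∈± {d} {e} 0≤e d²≤e² = bounds
    (0≤y-x (bound d d²≤e²))
    (subst (0# ≤_) (solve 2 (λ d e → e :- (:- d) := e :+ d) refl d e)
           (0≤y-x (bound (- d) (subst (_≤ e * e) (sym (square-neg d)) d²≤e²))))
    where
    bound : ∀ x → x * x ≤ e * e → x ≤ e
    bound x x²≤e² with x ≤? e
    ... | yes x≤e = x≤e
    ... | no  x≰e = ⊥-elim (<⇒≱ (subst (0# <_) (solve 2 (λ x e → (x :- e) :* ((x :- e) :+ (e :+ e)) := x :* x :- e :* e) refl x e)
                             (*-pos 0<x-e (+-pos 0<x-e (+-nonneg 0≤e 0≤e))))
                      (subst₂ _≤_ (+-comm _ _) (-‿inverseˡ (e * e)) (+-monoʳ-≤ (- (e * e)) x²≤e²)))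
      where
      0<x-e = 0<y-x (≰⇒> x≰e)

  -- A positive value is refuted by taking ε to be its half; the negated value is treated alike.
  ∈±-all⇒≡0 : ∀ {d} → (∀ ε → 0# < ε → d ∈± ε) → d ≡ 0#
  ∈±-all⇒≡0 {d} h = ≤-antisym (nonpos d (λ ε 0<ε → upper (h ε 0<ε)))
    (subst₂ _≤_ (solve 0 (con (pos 0) := con (pos 0)) refl) (solve 1 (λ d → :- (:- d) := d) refl d)
      (neg-nonneg (nonpos (- d) (λ ε 0<ε → upper (∈±-neg (h ε 0<ε))))))
    where
    nonpos : ∀ x → (∀ ε → 0# < ε → 0# ≤ ε - x) → x ≤ 0#
    nonpos x h with x ≤? 0#
    ... | yes x≤0 = x≤0
    ... | no  x≰0 with half (≰⇒> x≰0)
    ...   | δ , 0<δ , refl = ⊥-elim (<⇒≱ 0<δ (0≤y-x⇒x≤y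
              (subst (0# ≤_) (solve 1 (λ d → d :- (d :+ d) := con (pos 0) :- d) refl δ) (h δ 0<δ))))

-- Limits of real sequences.

module Limits (R : RealNumbers) where
  open RealNumbers R
  open SquareRoot R
  open IntegerCoefficients R
  open Solver
  open OrderedField R

  Lim : (ℕ → ℝ) → ℝ → Set
  Lim s x = ∀ ε → 0# < ε → ∃[ N ] ∀ n → N ℕ.≤ n → s n - x ∈± ε

  lim-cong : ∀ {s t x} → (∀ n → s n ≡ t n) → Lim s x → Lim t x
  lim-cong {x = x} s≡t h ε 0<ε with h ε 0<ε
  ... | N , near = N , λ n N≤n → subst (λ y → y - x ∈± ε) (s≡t n) (near n N≤n)

  lim-subsequence : ∀ {s x} (φ : ℕ → ℕ) → (∀ n → n ℕ.≤ φ n) → Lim s x → Lim (s ∘ φ) x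
  lim-subsequence φ n≤φn h ε 0<ε with h ε 0<ε
  ... | N , near = N , λ n N≤n → near (φ n) (ℕ.≤-trans N≤n (n≤φn n))

  lim-const : ∀ x → Lim (λ _ → x) x
  lim-const x ε 0<ε = 0 , λ n _ → subst (_∈± ε) (sym (-‿inverseʳ x))
    (∈±-mono (proj₁ 0<ε) (nonneg-∈± ≤-refl))

  lim-- : ∀ {s t x y} → Lim s x → Lim t y → Lim (λ n → s n - t n) (x - y)
  lim-- {s} {t} {x} {y} hs ht ε 0<ε with half 0<ε
  ... | δ , 0<δ , refl with hs δ 0<δ | ht δ 0<δ
  ...   | N , near | M , near′ = N ℕ.⊔ M , λ n h → subst (_∈± δ + δ)
            (solve 4 (λ s t x y → (s :- x) :- (t :- y) := (s :- t) :- (x :- y)) refl (s n) (t n) x y)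
            (∈±-- (near n (ℕ.≤-trans (ℕ.m≤m⊔n N M) h)) (near′ n (ℕ.≤-trans (ℕ.m≤n⊔m N M) h)))

  lim-neg : ∀ {s x} → Lim s x → Lim (λ n → - s n) (- x)
  lim-neg {s} {x} h ε 0<ε with h ε 0<ε
  ... | N , near = N , λ n N≤n → subst (_∈± ε)
          (solve 2 (λ s x → :- (s :- x) := (:- s) :- (:- x)) refl (s n) x) (∈±-neg (near n N≤n))

  lim-+ : ∀ {s t x y} → Lim s x → Lim t y → Lim (λ n → s n + t n) (x + y)
  lim-+ {s} {t} {x} {y} hs ht = subst (Lim _) (solve 2 (λ x y → x :- (:- y) := x :+ y) refl x y)
    (lim-cong (λ n → solve 2 (λ x y → x :- (:- y) := x :+ y) refl (s n) (t n)) (lim-- hs (lim-neg ht)))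

  lim-* : ∀ {s t x y} → Lim s x → Lim t y → Lim (λ n → s n * t n) (x * y)
  lim-* {s} {t} {x} {y} hs ht ε 0<ε with magnitude x | magnitude y
  -- The error of a product is (s - x)(t - y) + x (t - y) + (s - x) y, at most δ² + Bδ + δC; since δ
  -- ≤ 1 this is at most δ (1 + B + C).
  ... | B , 0≤B , x∈±B | C , 0≤C , y∈±C with shrink 0<ε (+-pos 0<1 (+-nonneg 0≤B 0≤C))
  ...   | δ , 0<δ , δ≤1 , δK≤ε with hs δ 0<δ | ht δ 0<δ
  ...     | N , near | M , near′ = N ℕ.⊔ M , λ n h →
              let ds = near n (ℕ.≤-trans (ℕ.m≤m⊔n N M) h)
                  dt = near′ n (ℕ.≤-trans (ℕ.m≤n⊔m N M) h)
              in subst (_∈± ε)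
                   (solve 4 (λ s t x y → (s :- x) :* (t :- y) :+ (x :* (t :- y) :+ (s :- x) :* y)
                                      := s :* t :- x :* y) refl (s n) (t n) x y)
                   (∈±-mono (≤-trans error δK≤ε)
                     (∈±-+ (∈±-* ds dt) (∈±-+ (∈±-* x∈±B dt) (∈±-* ds y∈±C))))
    where
    error : δ * δ + (B * δ + δ * C) ≤ δ * (1# + (B + C))
    error = ≤-by (*-nonneg (proj₁ 0<δ) (0≤y-x δ≤1))
      (solve 3 (λ d B C → d :* (con (pos 1) :+ (B :+ C)) := d :* d :+ (B :* d :+ d :* C) :+ d :* (con (pos 1) :- d)) refl δ B C)

  lim-nonneg : ∀ {s x} N → (∀ n → N ℕ.≤ n → 0# ≤ s n) → Lim s x → 0# ≤ x
  lim-nonneg {s} {x} N 0≤s lim with 0# ≤? x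
  ... | yes 0≤x = 0≤x
  ... | no  0≰x with half (neg-pos (≰⇒> 0≰x))
  ...   | δ , 0<δ , δ+δ≡-x with lim δ 0<δ
  ...     | M , near = ⊥-elim (<⇒≱ 0<δ (0≤y-x⇒x≤y (subst (0# ≤_) eq
              (+-nonneg (upper (near (N ℕ.⊔ M) (ℕ.m≤n⊔m N M))) (0≤s (N ℕ.⊔ M) (ℕ.m≤m⊔n N M))))))
    where
    eq : δ - (s (N ℕ.⊔ M) - x) + s (N ℕ.⊔ M) ≡ 0# - δ
    eq = trans (solve 3 (λ d s x → d :- (s :- x) :+ s := d :- (:- x)) refl δ (s (N ℕ.⊔ M)) x)
               (trans (cong (λ z → δ - z) (sym δ+δ≡-x)) (solve 1 (λ d → d :- (d :+ d) := con (pos 0) :- d) refl δ))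

  lim-∈± : ∀ {s x e} N → (∀ n → N ℕ.≤ n → s n ∈± e) → Lim s x → x ∈± e
  lim-∈± {e = e} N bound lim = bounds
      (lim-nonneg N (λ n N≤n → upper (bound n N≤n)) (lim-- (lim-const e) lim))
      (lim-nonneg N (λ n N≤n → lower (bound n N≤n)) (lim-+ (lim-const e) lim))

  lim-unique : ∀ {s x y} → Lim s x → Lim s y → x ≡ y
  lim-unique {s} {x} {y} hx hy = trans
    (solve 2 (λ x y → x := y :+ (x :- y)) refl x y)
    (trans (cong (y +_) (∈±-all⇒≡0 close)) (+-identityʳ y))
    where
    close : ∀ ε → 0# < ε → x - y ∈± ε
    close ε 0<ε with half 0<ε
    ... | δ , 0<δ , refl with hx δ 0<δ | hy δ 0<δ
    ...   | N , near | M , near′ = subst (_∈± δ + δ)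
              (solve 3 (λ s x y → (s :- y) :- (s :- x) := x :- y) refl (s (N ℕ.⊔ M)) x y)
              (∈±-- (near′ _ (ℕ.m≤n⊔m N M)) (near _ (ℕ.m≤m⊔n N M)))

-- Complex multiplication and powers.

module ComplexAlgebra (R : RealNumbers) where
  open RealNumbers R
  open SquareRoot R
  open Complex R
  open IntegerCoefficients R
  open Solver
  open OrderedField R
  open RawHyperfield ℂ-hyperfield using (_^_)

  *ℂ-assoc : ∀ x y z → (x *ℂ y) *ℂ z ≡ x *ℂ (y *ℂ z)
  *ℂ-assoc (complex a b) (complex c d) (complex e f) = cong₂ complex
    (solve 6 (λ a b c d e f → (a :* c :- b :* d) :* e :- (a :* d :+ b :* c) :* f
                           := a :* (c :* e :- d :* f) :- b :* (c :* f :+ d :* e)) refl a b c d e f)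
    (solve 6 (λ a b c d e f → (a :* c :- b :* d) :* f :+ (a :* d :+ b :* c) :* e
                           := a :* (c :* f :+ d :* e) :+ b :* (c :* e :- d :* f)) refl a b c d e f)

  *ℂ-identityˡ : ∀ z → 1ℂ *ℂ z ≡ z
  *ℂ-identityˡ (complex a b) = cong₂ complex
    (solve 2 (λ a b → con (pos 1) :* a :- con (pos 0) :* b := a) refl a b)
    (solve 2 (λ a b → con (pos 1) :* b :+ con (pos 0) :* a := b) refl a b)

  *ℂ-identityʳ : ∀ z → z *ℂ 1ℂ ≡ z
  *ℂ-identityʳ (complex a b) = cong₂ complex
    (solve 2 (λ a b → a :* con (pos 1) :- b :* con (pos 0) := a) refl a b)
    (solve 2 (λ a b → a :* con (pos 0) :+ b :* con (pos 1) := b) refl a b)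

  ^-+ : ∀ z m n → z ^ (m ℕ.+ n) ≡ z ^ m *ℂ z ^ n
  ^-+ z zero    n = sym (*ℂ-identityˡ _)
  ^-+ z (suc m) n = trans (cong (z *ℂ_) (^-+ z m n)) (sym (*ℂ-assoc z _ _))

  ^-* : ∀ z m n → z ^ (m ℕ.* n) ≡ (z ^ n) ^ m
  ^-* z zero    n = refl
  ^-* z (suc m) n = trans (^-+ z n (m ℕ.* n)) (cong (z ^ n *ℂ_) (^-* z m n))

  im-square : ∀ z → im (z *ℂ z) ≡ (1# + 1#) * (re z * im z)
  im-square (complex a b) = solve 2 (λ a b →
    a :* b :+ b :* a := (con (pos 1) :+ con (pos 1)) :* (a :* b)) refl a b

-- Componentwise limits of complex sequences.

module ComplexLimits (R : RealNumbers) where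
  open RealNumbers R
  open SquareRoot R
  open Complex R
  open OrderedField R
  open Limits R
  open ComplexAlgebra R
  open RawHyperfield ℂ-hyperfield using (_^_)

  Limℂ : (ℕ → ℂ) → ℂ → Set
  Limℂ s z = Lim (re ∘ s) (re z) × Lim (im ∘ s) (im z)

  limℂ-cong : ∀ {s t z} → (∀ n → s n ≡ t n) → Limℂ s z → Limℂ t z
  limℂ-cong s≡t (h , k) = lim-cong (cong re ∘ s≡t) h , lim-cong (cong im ∘ s≡t) k

  limℂ-* : ∀ {s t z w} → Limℂ s z → Limℂ t w → Limℂ (λ n → s n *ℂ t n) (z *ℂ w)
  limℂ-* (a , b) (c , d) = lim-- (lim-* a c) (lim-* b d) , lim-+ (lim-* a d) (lim-* b c)

  limℂ-^ : ∀ {s z} → Limℂ s z → ∀ k → Limℂ (λ n → s n ^ k) (z ^ k)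
  limℂ-^ h zero    = lim-const 1# , lim-const 0#
  limℂ-^ h (suc k) = limℂ-* h (limℂ-^ h k)

  limℂ-unique : ∀ {s z w} → Limℂ s z → Limℂ s w → z ≡ w
  limℂ-unique (a , b) (c , d) = cong₂ complex (lim-unique a c) (lim-unique b d)

  re∈±∣∣ : ∀ z → re z ∈± ∣ z ∣
  re∈±∣∣ z = square-≤⇒∈± (∣∣-nonneg z)
    (≤-trans (x≤x+e _ (square-nonneg (im z))) (≤-reflexive (sym (∣∣*∣∣ z))))

  im∈±∣∣ : ∀ z → im z ∈± ∣ z ∣
  im∈±∣∣ z = square-≤⇒∈± (∣∣-nonneg z)
    (≤-trans (x≤x+e _ (square-nonneg (re z))) (≤-reflexive (trans (+-comm _ _) (sym (∣∣*∣∣ z)))))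

  convergesTo⇒limℂ : ∀ {s z} → ConvergesTo s z → Limℂ s z
  convergesTo⇒limℂ {s} {z} h =
      (λ ε 0<ε → let N , near = h ε 0<ε in N , λ n N≤n → ∈±-mono (proj₁ (near n N≤n)) (re∈±∣∣ (s n -ℂ z)))
    , (λ ε 0<ε → let N , near = h ε 0<ε in N , λ n N≤n → ∈±-mono (proj₁ (near n N≤n)) (im∈±∣∣ (s n -ℂ z)))

-- Euler's limit: integer multiples, Lipschitz bound and sign of sine.

module Exponential (R : RealNumbers) (exp : Complex.ℂ R → Complex.ℂ R)
                   (isExponential : Complex.IsExponential R exp) where
  open RealNumbers R
  open Complex R
  open SquareRoot R
  open IntegerCoefficients R
  open Solver
  open OrderedField R
  open Limits R
  open ComplexAlgebra R
  open ComplexLimits R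
  open RawHyperfield ℂ-hyperfield using (_^_)
  open SemiringExp (CommutativeRing.semiring commutativeRing) using () renaming (_^_ to _^ʳ_)

  euler : ℂ → ℕ → ℂ
  euler z n = (1ℂ +ℂ fromℕ (suc n) ⁻¹ • z) ^ suc n

  euler-lim : ∀ z → Limℂ (euler z) (exp z)
  euler-lim z = convergesTo⇒limℂ (isExponential z)

  -- The terms of index n = k m in Euler's limit for k z are the k-th powers
  -- of the terms of index m in the limit for z.

  exp-multiple : ∀ k z → exp (fromℕ (suc k) • z) ≡ exp z ^ suc k
  exp-multiple k z = limℂ-unique
    (limℂ-cong step (lim-subsequence φ m≤φm (proj₁ kz-lim) , lim-subsequence φ m≤φm (proj₂ kz-lim)))
    (limℂ-^ (euler-lim z) (suc k))
    where
    kz-lim = euler-lim (fromℕ (suc k) • z)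

    -- Index n stands for the exponent `suc n`; with this φ, `suc (φ m)` is `suc k ℕ.* suc m` by
    -- computation.
    φ : ℕ → ℕ
    φ m = m ℕ.+ k ℕ.* suc m

    m≤φm : ∀ m → m ℕ.≤ φ m
    m≤φm m = ℕ.m≤m+n m _

    cancel : ∀ m x → fromℕ (suc (φ m)) ⁻¹ * (fromℕ (suc k) * x) ≡ fromℕ (suc m) ⁻¹ * x
    -- Both sides are compared after multiplication by the nonzero `K * M`, so the inverse of the
    -- product is never expanded.
    cancel m x = trans (cong (λ y → y ⁻¹ * (K * x)) (fromℕ-* (suc k) (suc m)))
      (*-cancelˡ KM≢0 (trans
        (trans (sym (*-assoc (K * M) _ _)) (trans (cong (_* (K * x)) (*-inverseʳ KM≢0)) (*-identityˡ _)))
        (sym (trans (solve 4 (λ K M N x → K :* M :* (N :* x) := (M :* N) :* (K :* x)) refl K M (M ⁻¹) x)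
                    (trans (cong (_* (K * x)) (*-inverseʳ (pos⇒≢0 (fromℕ-pos m)))) (*-identityˡ _))))))
      where
      K = fromℕ (suc k)
      M = fromℕ (suc m)
      KM≢0 : K * M ≢ 0#
      KM≢0 = *-≢0 (pos⇒≢0 (fromℕ-pos k)) (pos⇒≢0 (fromℕ-pos m))

    step : ∀ m → euler (fromℕ (suc k) • z) (φ m) ≡ euler z m ^ suc k
    step m = trans
      (cong (λ w → (1ℂ +ℂ w) ^ suc (φ m)) (cong₂ complex (cancel m (re z)) (cancel m (im z))))
      (^-* (1ℂ +ℂ fromℕ (suc m) ⁻¹ • z) (suc k) (suc m))

  exp-i-multiple : ∀ k t → exp (i· (fromℕ (suc k) * t)) ≡ exp (i· t) ^ suc k
  exp-i-multiple k t = trans (cong (λ x → exp (complex x (fromℕ (suc k) * t))) (sym (zeroʳ _)))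
                             (exp-multiple k (i· t))

  power : ℝ → ℕ → ℂ
  power y k = complex 1# y ^ k

  euler-i : ∀ t n → euler (i· t) n ≡ power (fromℕ (suc n) ⁻¹ * t) (suc n)
  euler-i t n = cong (_^ suc n) (cong₂ complex
    (solve 1 (λ v → con (pos 1) :+ v :* con (pos 0) := con (pos 1)) refl (fromℕ (suc n) ⁻¹))
    (+-identityˡ _))

  ^ʳ-nonneg : ∀ {x} k → 0# ≤ x → 0# ≤ x ^ʳ k
  ^ʳ-nonneg zero    0≤x = 0≤1
  ^ʳ-nonneg (suc k) 0≤x = *-nonneg 0≤x (^ʳ-nonneg k 0≤x)

  -- One more factor 1 + i y sends (A, B) to (A - y B, B + y A), and either entry grows at most by
  -- the factor 1 + Y.
  power-bound : ∀ {y Y} k → y ∈± Y → re (power y k) ∈± (1# + Y) ^ʳ k × im (power y k) ∈± (1# + Y) ^ʳ k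
  power-bound zero h = nonneg-∈± 0≤1 , ∈±-mono 0≤1 (nonneg-∈± ≤-refl)
  power-bound {y} {Y} (suc k) h with power-bound k h
  ... | p , q = widen (∈±-- (∈±-* (nonneg-∈± 0≤1) p) (∈±-* h q))
              , widen (∈±-+ (∈±-* (nonneg-∈± 0≤1) q) (∈±-* h p))
    where
    widen : ∀ {d} → d ∈± 1# * (1# + Y) ^ʳ k + Y * (1# + Y) ^ʳ k → d ∈± (1# + Y) ^ʳ suc k
    widen = ∈±-mono (≤-reflexive (sym (distribʳ _ 1# Y)))

  -- One more factor changes a difference by z times the other difference plus (z - y) times an old
  -- component. The exponent k in place of k - 1 leaves the slack Yδ(1 + Y)^k that closes the
  -- induction.
  power-lipschitz : ∀ {y z Y δ} k → y ∈± Y → z ∈± Y → z - y ∈± δ →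
    let bound = fromℕ k * δ * (1# + Y) ^ʳ k in
    re (power z k) - re (power y k) ∈± bound × im (power z k) - im (power y k) ∈± bound
  power-lipschitz {δ = δ} zero hy hz h = zero-∈± , zero-∈±
    where
    zero-∈± : ∀ {x} → x - x ∈± 0# * δ * 1#
    zero-∈± {x} = subst₂ _∈±_ (sym (-‿inverseʳ x)) (solve 1 (λ d → con (pos 0) := con (pos 0) :* d :* con (pos 1)) refl δ)
                    (nonneg-∈± ≤-refl)
  power-lipschitz {y} {z} {Y} {δ} (suc k) hy hz h with power-lipschitz {y} {z} {Y} {δ} k hy hz h | power-bound k hy
  ... | p , q | a , b =
      widen (∈±-cong
        (solve 6 (λ y z A B C D → (C :- A) :- (z :* (D :- B) :+ (z :- y) :* B)
             := (con (pos 1) :* C :- z :* D) :- (con (pos 1) :* A :- y :* B)) refl y z A B C D)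
        (∈±-- p (∈±-+ (∈±-* hz q) (∈±-* h b))))
    , widen (∈±-cong
        (solve 6 (λ y z A B C D → (D :- B) :+ (z :* (C :- A) :+ (z :- y) :* A)
             := (con (pos 1) :* D :+ z :* C) :- (con (pos 1) :* B :+ y :* A)) refl y z A B C D)
        (∈±-+ q (∈±-+ (∈±-* hz p) (∈±-* h a))))
    where
    A = re (power y k)
    B = im (power y k)
    C = re (power z k)
    D = im (power z k)
    ρ = (1# + Y) ^ʳ k
    0≤Y : 0# ≤ Y
    0≤Y = ∈±-bound-nonneg hy
    widen : ∀ {d} → d ∈± fromℕ k * δ * ρ + (Y * (fromℕ k * δ * ρ) + δ * ρ) →
            d ∈± fromℕ (suc k) * δ * ((1# + Y) * ρ)
    widen = ∈±-mono (≤-by (*-nonneg 0≤Y (*-nonneg (∈±-bound-nonneg h) (^ʳ-nonneg k (+-nonneg 0≤1 0≤Y))))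
      (solve 4 (λ K d r Y → (con (pos 1) :+ K) :* d :* ((con (pos 1) :+ Y) :* r)
        := K :* d :* r :+ (Y :* (K :* d :* r) :+ d :* r) :+ Y :* (d :* r)) refl (fromℕ k) δ ρ Y))

  ofℝ-^ : ∀ x k → ofℝ x ^ k ≡ ofℝ (x ^ʳ k)
  ofℝ-^ x zero    = refl
  ofℝ-^ x (suc k) = trans (cong (ofℝ x *ℂ_) (ofℝ-^ x k)) (cong₂ complex
    (solve 2 (λ x y → x :* y :- con (pos 0) :* con (pos 0) := x :* y) refl x (x ^ʳ k))
    (solve 2 (λ x y → x :* con (pos 0) :+ con (pos 0) :* y := con (pos 0)) refl x (x ^ʳ k)))

  euler-real : ∀ x n → re (euler (ofℝ x) n) ≡ (1# + fromℕ (suc n) ⁻¹ * x) ^ʳ suc n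
  euler-real x n = trans
    (cong (λ w → re (complex (1# + fromℕ (suc n) ⁻¹ * x) w ^ suc n))
      (solve 1 (λ v → con (pos 0) :+ v :* con (pos 0) := con (pos 0)) refl (fromℕ (suc n) ⁻¹)))
    (cong re (ofℝ-^ (1# + fromℕ (suc n) ⁻¹ * x) (suc n)))

  sin : ℝ → ℝ
  sin t = im (exp (i· t))

  -- (1 + T/n)ⁿ is bounded because it converges to exp T.

  sin-lipschitz : ∀ T → ∃[ L ] 0# < L ×
    (∀ {s t δ} → s ∈± T → t ∈± T → t - s ∈± δ → sin t - sin s ∈± δ * L)
  sin-lipschitz T = 1# + M , +-pos 0<1 0≤M , lipschitz
    where
    expT-magnitude : ∃[ e ] 0# ≤ e × re (exp (ofℝ T)) ∈± e
    expT-magnitude = magnitude (re (exp (ofℝ T)))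
    M = proj₁ expT-magnitude
    0≤M = proj₁ (proj₂ expT-magnitude)
    exp∈±M = proj₂ (proj₂ expT-magnitude)

    eventually : ∃[ N ] ∀ n → N ℕ.≤ n → re (euler (ofℝ T) n) - re (exp (ofℝ T)) ∈± 1#
    eventually = proj₁ (euler-lim (ofℝ T)) 1# 0<1
    N = proj₁ eventually
    near = proj₂ eventually

    lipschitz : ∀ {s t δ} → s ∈± T → t ∈± T → t - s ∈± δ → sin t - sin s ∈± δ * (1# + M)
    lipschitz {s} {t} {δ} hs ht h =
      lim-∈± N bound (lim-- (proj₂ (euler-lim (i· t))) (proj₂ (euler-lim (i· s))))
      where
      bound : ∀ n → N ℕ.≤ n → im (euler (i· t) n) - im (euler (i· s) n) ∈± δ * (1# + M)
      bound n N≤n = subst₂ (λ z w → im z - im w ∈± δ * (1# + M)) (sym (euler-i t n)) (sym (euler-i s n))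
        (∈±-mono bound≤ (proj₂ (power-lipschitz (suc n) (scale hs) (scale ht)
          (∈±-cong (solve 3 (λ v s t → v :* (t :- s) := v :* t :- v :* s) refl ν s t) (scale h)))))
        where
        ν = fromℕ (suc n) ⁻¹
        ρ = (1# + ν * T) ^ʳ suc n

        scale : ∀ {d e} → d ∈± e → ν * d ∈± ν * e
        scale = ∈±-* (nonneg-∈± (proj₁ (⁻¹-pos (fromℕ-pos n))))

        -- From index N on, ρ is within 1 of re (exp T), which is at most M.
        ρ≤ : ρ ≤ 1# + M
        ρ≤ = 0≤y-x⇒x≤y (subst (0# ≤_)
          (trans (cong (λ r → (1# - (r - re (exp (ofℝ T)))) + (M - re (exp (ofℝ T)))) (euler-real T n))
                 (solve 3 (λ r x M → (con (pos 1) :- (r :- x)) :+ (M :- x) := con (pos 1) :+ M :- r) refl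
                    ρ (re (exp (ofℝ T))) M))
          (+-nonneg (upper (near n N≤n)) (upper exp∈±M)))

        -- The factor n + 1 from the number of factors cancels the ν from scaling; this makes the
        -- constant independent of n.
        bound≤ : fromℕ (suc n) * (ν * δ) * ρ ≤ δ * (1# + M)
        bound≤ = subst (_≤ δ * (1# + M))
          (sym (cong (_* ρ) (trans (sym (*-assoc _ ν δ))
            (trans (cong (_* δ) (*-inverseʳ (pos⇒≢0 (fromℕ-pos n)))) (*-identityˡ δ)))))
          (subst₂ _≤_ (*-comm ρ δ) (*-comm (1# + M) δ) (*-monoˡ-≤ (∈±-bound-nonneg h) ρ≤))

  -- The four bounds support each other: B ≤ k y ≤ 1 limits the loss y B of the real part, so A
  -- stays in [0, 1], and this in turn keeps the increment y A of the imaginary part between 0 and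
  -- y.
  power-small : ∀ {y} k → 0# ≤ y → fromℕ k * y ≤ 1# →
    0# ≤ im (power y k) × im (power y k) ≤ fromℕ k * y ×
    1# - fromℕ k * y ≤ re (power y k) × re (power y k) ≤ 1#
  power-small {y} zero 0≤y h = ≤-refl , ≤-reflexive (sym (zeroˡ y))
    , ≤-reflexive (solve 1 (λ y → con (pos 1) :- con (pos 0) :* y := con (pos 1)) refl y) , ≤-refl
  power-small {y} (suc k) 0≤y h with power-small k 0≤y (≤-trans (≤-by 0≤y τ+y) h)
    where
    τ+y : fromℕ (suc k) * y ≡ fromℕ k * y + y
    τ+y = solve 2 (λ k y → (con (pos 1) :+ k) :* y := k :* y :+ y) refl (fromℕ k) y
  ... | 0≤B , B≤τ , 1-τ≤A , A≤1 =
      +-nonneg (*-nonneg 0≤1 0≤B) (*-nonneg 0≤y 0≤A)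
    , ≤-by (+-nonneg (0≤y-x B≤τ) (*-nonneg 0≤y (0≤y-x A≤1)))
        (solve 4 (λ k y A B → (con (pos 1) :+ k) :* y := con (pos 1) :* B :+ y :* A
           :+ ((k :* y :- B) :+ y :* (con (pos 1) :- A))) refl (fromℕ k) y A B)
    , ≤-by (+-nonneg (0≤y-x 1-τ≤A) (*-nonneg 0≤y (0≤y-x B≤1)))
        (solve 4 (λ k y A B → con (pos 1) :* A :- y :* B := con (pos 1) :- (con (pos 1) :+ k) :* y
           :+ ((A :- (con (pos 1) :- k :* y)) :+ y :* (con (pos 1) :- B))) refl (fromℕ k) y A B)
    , ≤-by (+-nonneg (0≤y-x A≤1) (*-nonneg 0≤y 0≤B))
        (solve 3 (λ y A B → con (pos 1) := con (pos 1) :* A :- y :* B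
           :+ ((con (pos 1) :- A) :+ y :* B)) refl y A B)
    where
    A = re (power y k)
    B = im (power y k)
    τ≤1 : fromℕ k * y ≤ 1#
    τ≤1 = ≤-trans (≤-by 0≤y (solve 2 (λ k y → (con (pos 1) :+ k) :* y := k :* y :+ y) refl (fromℕ k) y)) h
    B≤1 : B ≤ 1#
    B≤1 = ≤-trans B≤τ τ≤1
    0≤A : 0# ≤ A
    0≤A = ≤-trans (0≤y-x τ≤1) 1-τ≤A

  -- A limit preserves only the weak inequality; strictness is recovered later from the minimality
  -- of π.
  sin-nonneg-small : ∀ {t} → 0# ≤ t → t ≤ 1# → 0# ≤ sin t
  sin-nonneg-small {t} 0≤t t≤1 = lim-nonneg 0 nonneg (proj₂ (euler-lim (i· t)))
    where
    nonneg : ∀ n → 0 ℕ.≤ n → 0# ≤ im (euler (i· t) n)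
    nonneg n _ = subst (λ z → 0# ≤ im z) (sym (euler-i t n))
      (proj₁ (power-small (suc n) (*-nonneg (proj₁ (⁻¹-pos (fromℕ-pos n))) 0≤t)
        (subst (_≤ 1#) (sym (trans (sym (*-assoc _ _ t))
          (trans (cong (_* t) (*-inverseʳ (pos⇒≢0 (fromℕ-pos n)))) (*-identityˡ t)))) t≤1)))

-- Zeros of Lipschitz functions.

module IntermediateValue (R : RealNumbers) where
  open RealNumbers R
  open SquareRoot R
  open IntegerCoefficients R
  open Solver
  open OrderedField R

  -- The zero is the supremum of the points of [a, b] at which f is nonnegative.

  intermediate-zero : ∀ (f : ℝ → ℝ) {a b L} → 0# < L →
    (∀ {x y δ} → a ≤ x → x ≤ b → a ≤ y → y ≤ b → y - x ∈± δ → f y - f x ∈± δ * L) →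
    a ≤ b → 0# ≤ f a → f b < 0# → ∃[ s ] a ≤ s × s ≤ b × f s ≡ 0#
  intermediate-zero f {a} {b} {L} 0<L lipschitz a≤b 0≤fa fb<0 =
    s , a≤s , s≤b , ≤-antisym (≮⇒≥ ¬0<fs) (≮⇒≥ ¬fs<0)
    where
    A : ℝ → Set
    A x = a ≤ x × x ≤ b × 0# ≤ f x

    sup : ∃[ s ] UpperBound A s × (∀ {u} → UpperBound A u → s ≤ u)
    sup = supremum A (a , ≤-refl , a≤b , 0≤fa) (b , proj₁ ∘ proj₂)

    s : ℝ
    s = proj₁ sup

    s-bound : UpperBound A s
    s-bound = proj₁ (proj₂ sup)

    s-least : ∀ {u} → UpperBound A u → s ≤ u
    s-least = proj₂ (proj₂ sup)

    a≤s : a ≤ s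
    a≤s = s-bound (≤-refl , a≤b , 0≤fa)

    s≤b : s ≤ b
    s≤b = s-least (proj₁ ∘ proj₂)

    step-right : ∀ {δ} → 0# ≤ δ → s + δ ≤ b → δ * L ≤ f s → A (s + δ)
    step-right {δ} 0≤δ s+δ≤b δL≤fs = a≤s+δ , s+δ≤b , subst (0# ≤_)
      (solve 3 (λ e x y → (e :+ (x :- y)) :+ (y :- e) := x) refl (δ * L) (f (s + δ)) (f s))
      (+-nonneg (lower (lipschitz a≤s s≤b a≤s+δ s+δ≤b
                  (∈±-cong (solve 2 (λ s d → d := (s :+ d) :- s) refl s δ) (nonneg-∈± 0≤δ))))
                (0≤y-x δL≤fs))
      where
      a≤s+δ : a ≤ s + δ
      a≤s+δ = ≤-trans a≤s (x≤x+e s 0≤δ)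

    no-step-right : ∀ {δ} → 0# < δ → s + δ ≤ b → ¬ (δ * L ≤ f s)
    no-step-right {δ} 0<δ s+δ≤b h = <⇒≱ 0<δ (0≤y-x⇒x≤y (subst (0# ≤_)
      (solve 2 (λ s d → s :- (s :+ d) := con (pos 0) :- d) refl s δ)
      (0≤y-x (s-bound (step-right (proj₁ 0<δ) s+δ≤b h)))))

    ¬0<fs : ¬ 0# < f s
    ¬0<fs 0<fs with shrink 0<fs 0<L
    ... | δ , 0<δ , _ , δL≤ with s + δ ≤? b
    ...   | yes s+δ≤b = no-step-right 0<δ s+δ≤b δL≤
    -- A step past b is shortened to end at b; it is still positive, since s = b would contradict f
    -- b < 0 < f s.
    ...   | no  s+δ≰b = no-step-right {b - s}
              (0<y-x (s≤b , λ s≡b → <⇒≱ fb<0 (subst (λ x → 0# ≤ f x) s≡b (proj₁ 0<fs))))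
              (≤-reflexive (solve 2 (λ s b → s :+ (b :- s) := b) refl s b))
              (≤-trans (*-monoˡ-≤ (proj₁ 0<L) (0≤y-x⇒x≤y (subst (0# ≤_)
                 (solve 3 (λ s b d → (s :+ d) :- b := d :- (b :- s)) refl s b δ) (0≤y-x (≰⇒≥ s+δ≰b))))) δL≤)

    -- If f s < 0, then already s - δ bounds the set.
    ¬fs<0 : ¬ f s < 0#
    ¬fs<0 fs<0 with half (neg-pos fs<0)
    -- With f s = -2ε and δL ≤ ε, a point of the set beyond s - δ would have f at most -ε,
    -- contradicting 0 ≤ f x.
    ... | ε , 0<ε , ε+ε≡-fs with shrink 0<ε 0<L
    ...   | δ , 0<δ , _ , δL≤ε = <⇒≱ 0<δ (0≤y-x⇒x≤y (subst (0# ≤_)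
              (solve 2 (λ s d → (s :- d) :- s := con (pos 0) :- d) refl s δ) (0≤y-x (s-least bound))))
      where
      bound : UpperBound A (s - δ)
      bound {x} x∈A@(a≤x , x≤b , 0≤fx) with x ≤? s - δ
      ... | yes x≤s-δ = x≤s-δ
      ... | no  x≰s-δ = ⊥-elim (<⇒≱ 0<ε (0≤y-x⇒x≤y (subst (0# ≤_) eq
              (+-nonneg (+-nonneg (upper (lipschitz a≤s s≤b a≤x x≤b close)) (0≤y-x δL≤ε)) 0≤fx))))
        where
        close : x - s ∈± δ
        close = ∈±-cong (solve 2 (λ x s → :- (s :- x) := x :- s) refl x s)
          (∈±-neg (∈±-mono (0≤y-x⇒x≤y (subst (0# ≤_)
            (solve 3 (λ x s d → x :- (s :- d) := d :- (s :- x)) refl x s δ) (0≤y-x (≰⇒≥ x≰s-δ))))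
            (nonneg-∈± (0≤y-x (s-bound x∈A)))))
        eq : δ * L - (f x - f s) + (ε - δ * L) + f x ≡ 0# - ε
        eq = trans (solve 4 (λ e x y z → e :- (x :- y) :+ (z :- e) :+ x := z :- (:- y)) refl (δ * L) (f x) (f s) ε)
               (trans (cong (λ y → ε - y) (sym ε+ε≡-fs))
                      (solve 1 (λ e → e :- (e :+ e) := con (pos 0) :- e) refl ε))

-- The sign of sine on (0, π) and the three exponentials.

module Angles (R : RealNumbers) (exp : Complex.ℂ R → Complex.ℂ R)
              (isExponential : Complex.IsExponential R exp)
              (π : RealNumbers.ℝ R) (isPi : Complex.IsPi R exp π) where
  open RealNumbers R
  open Complex R
  open SquareRoot R
  open IntegerCoefficients R
  open Solver
  open OrderedField R
  open ComplexAlgebra R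
  open IntermediateValue R
  open Exponential R exp isExponential

  0<π : 0# < π
  0<π = proj₁ isPi

  -- A negative value can occur only beyond 1, and then sine has a zero in [1, t], before π.
  -- Searching from 1 instead of 0 keeps that zero positive.
  sin-≮0 : ∀ {t} → 0# < t → t < π → ¬ sin t < 0#
  sin-≮0 {t} 0<t t<π sint<0 = <⇒≱ sint<0 (sin-nonneg-small (proj₁ 0<t) (≮⇒≥ 1≮t))
    where
    1≮t : ¬ 1# < t
    1≮t (1≤t , _) = proj₂ (proj₂ isPi) (proj₁ zero-of-sin) (<-≤-trans 0<1 1≤s) (≤-<-trans s≤t t<π) sins≡0
      where
      zero-of-sin : ∃[ s ] 1# ≤ s × s ≤ t × sin s ≡ 0#
      zero-of-sin = intermediate-zero sin (proj₁ (proj₂ (sin-lipschitz t)))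
        (λ 1≤x x≤t 1≤y y≤t → proj₂ (proj₂ (sin-lipschitz t)) (in-range 1≤x x≤t) (in-range 1≤y y≤t))
        1≤t (sin-nonneg-small 0≤1 ≤-refl) sint<0
        where
        in-range : ∀ {x} → 1# ≤ x → x ≤ t → x ∈± t
        in-range 1≤x x≤t = ∈±-mono x≤t (nonneg-∈± (≤-trans 0≤1 1≤x))
      1≤s = proj₁ (proj₂ zero-of-sin)
      s≤t = proj₁ (proj₂ (proj₂ zero-of-sin))
      sins≡0 = proj₂ (proj₂ (proj₂ zero-of-sin))

  sin-pos : ∀ {t} → 0# < t → t < π → 0# < sin t
  sin-pos {t} 0<t t<π with 0# ≤? sin t
  ... | yes 0≤sint = 0≤sint , proj₂ (proj₂ isPi) t 0<t t<π ∘ sym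
  ... | no  0≰sint = ⊥-elim (sin-≮0 0<t t<π (≰⇒> 0≰sint))

  -- Both sides are powers of `exp (i· t)`; this is the substitute for the addition formula.
  exp-i-suc : ∀ k t → exp (i· (fromℕ (suc (suc k)) * t)) ≡ exp (i· t) *ℂ exp (i· (fromℕ (suc k) * t))
  exp-i-suc k t = trans (exp-i-multiple (suc k) t) (cong (exp (i· t) *ℂ_) (sym (exp-i-multiple k t)))

  fromℕ-*-/ : ∀ n → fromℕ (suc n) * (π / suc n) ≡ π
  fromℕ-*-/ n = trans (solve 3 (λ n p m → n :* (p :* m) := (n :* m) :* p) refl (fromℕ (suc n)) π (fromℕ (suc n) ⁻¹))
    (trans (cong (_* π) (*-inverseʳ (pos⇒≢0 (fromℕ-pos n)))) (*-identityˡ π))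

  /-pos : ∀ n → 0# < π / suc n
  /-pos n = *-pos 0<π (⁻¹-pos (fromℕ-pos n))

  -- The denominator has the form m + k + 1, so π exceeds the multiple by the k + 1 remaining
  -- shares.
  fraction<π : ∀ m k → fromℕ m * (π / suc (m ℕ.+ k)) < π
  fraction<π m k = subst (fromℕ m * t <_) whole
    ( x≤x+e _ (proj₁ 0<r)
    , λ eq → pos⇒≢0 0<r (+-cancel (fromℕ m * t) (trans (+-identityʳ _) eq)))
    where
    t = π / suc (m ℕ.+ k)
    r = fromℕ (suc k) * t
    0<r : 0# < r
    0<r = *-pos (fromℕ-pos k) (/-pos (m ℕ.+ k))
    +-cancel : ∀ x {y} → x + 0# ≡ x + y → y ≡ 0#
    +-cancel x {y} eq = trans (solve 2 (λ x y → y := (x :+ y) :- x) refl x y)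
      (trans (cong (_- x) (sym eq)) (solve 1 (λ x → (x :+ con (pos 0)) :- x := con (pos 0)) refl x))
    whole : fromℕ m * t + r ≡ π
    whole = trans (solve 3 (λ m k t → m :* t :+ (con (pos 1) :+ k) :* t := (con (pos 1) :+ (m :+ k)) :* t) refl (fromℕ m) (fromℕ k) t)
      (trans (cong (λ x → (1# + x) * t) (sym (fromℕ-+ m k))) (fromℕ-*-/ (m ℕ.+ k)))

  1*/ : ∀ n → fromℕ 1 * (π / n) ≡ π / n
  1*/ n = solve 1 (λ x → (con (pos 1) :+ con (pos 0)) :* x := x) refl (π / n)

  sin-fraction-pos : ∀ m k → 0# < sin (fromℕ (suc m) * (π / suc (suc m ℕ.+ k)))
  sin-fraction-pos m k = sin-pos (*-pos (fromℕ-pos m) (/-pos (suc m ℕ.+ k))) (fraction<π (suc m) k)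

  sin-/-pos : ∀ k → 0# < sin (π / suc (suc k))
  sin-/-pos k = subst (λ x → 0# < sin x) (1*/ (suc (suc k))) (sin-fraction-pos 0 k)

  exp-double : ∀ t → exp (i· (fromℕ 2 * t)) ≡ exp (i· t) *ℂ exp (i· t)
  exp-double t = trans (exp-i-suc 0 t)
    (cong (λ x → exp (i· t) *ℂ exp (i· x)) (solve 1 (λ x → (con (pos 1) :+ con (pos 0)) :* x := x) refl t))

  -- From sin 2t = 2 sin t cos t: for a denominator of at least 3, both t and 2t lie in (0, π).
  re-/-pos : ∀ k → 0# < re (exp (i· (π / suc (suc (suc k)))))
  re-/-pos k = *-cancel-pos (sin-/-pos (suc k)) (*-cancel-pos 0<2
    (subst (0# <_) (trans (cong im (exp-double t))
      (trans (im-square (exp (i· t))) (cong ((1# + 1#) *_) (*-comm _ _)))) (sin-fraction-pos 1 k)))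
    where
    t = π / suc (suc (suc k))

  -- The imaginary part of v² is sin π = 0 and also 2 re v im v with im v > 0; so re v = 0, and
  -- modulus 1 leaves v = i.
  exp-iπ/2 : ∣ exp (i· (π / 2)) ∣² ≡ 1# → exp (i· (π / 2)) ≡ i· 1#
  exp-iπ/2 ∣v∣²≡1 = cong₂ complex re≡0 (unit-square (sin-/-pos 0)
    (trans (solve 1 (λ y → y :* y := con (pos 0) :* con (pos 0) :+ y :* y) refl (im v))
           (trans (cong (λ x → x * x + im v * im v) (sym re≡0)) ∣v∣²≡1)))
    where
    v = exp (i· (π / 2))
    im-v²≡0 : im (v *ℂ v) ≡ 0#
    im-v²≡0 = trans (cong im (sym (exp-double (π / 2)))) (trans (cong sin (fromℕ-*-/ 1)) (proj₁ (proj₂ isPi)))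
    re≡0 : re v ≡ 0#
    re≡0 = *-cancelˡ (pos⇒≢0 (sin-/-pos 0)) (*-cancelˡ (pos⇒≢0 0<2)
      (trans (cong ((1# + 1#) *_) (*-comm _ _)) (trans (sym (im-square v)) (trans im-v²≡0
        (solve 1 (λ x → con (pos 0) := (con (pos 1) :+ con (pos 1)) :* (x :* con (pos 0))) refl (im v))))))
    unit-square : ∀ {y} → 0# < y → y * y ≡ 1# → y ≡ 1#
    unit-square {y} 0<y y²≡1 = *-cancelˡ (pos⇒≢0 (+-pos 0<1 (proj₁ 0<y)))
      (trans (solve 1 (λ y → (con (pos 1) :+ y) :* y := y :+ y :* y) refl y)
        (trans (cong (y +_) y²≡1) (solve 1 (λ y → y :+ con (pos 1) := (con (pos 1) :+ y) :* con (pos 1)) refl y)))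

  exp-iπ : ∣ exp (i· (π / 2)) ∣² ≡ 1# → exp (i· π) ≡ -ℂ 1ℂ
  exp-iπ h = trans (cong (λ x → exp (i· x)) (sym (fromℕ-*-/ 1))) (trans (exp-double (π / 2))
    (trans (cong₂ _*ℂ_ (exp-iπ/2 h) (exp-iπ/2 h)) (cong₂ complex
      (solve 0 (con (pos 0) :* con (pos 0) :- con (pos 1) :* con (pos 1) := :- con (pos 1)) refl)
      (solve 0 (con (pos 0) :* con (pos 1) :+ con (pos 1) :* con (pos 0) := :- con (pos 0)) refl))))

  -- Multiplying z w = -1 by the conjugate of z isolates w, because |z|² = 1.
  reflect : ∀ z w → ∣ z ∣² ≡ 1# → z *ℂ w ≡ -ℂ 1ℂ → w ≡ complex (- re z) (im z)
  reflect (complex a b) (complex c d) ∣z∣²≡1 zw≡-1 = cong₂ complex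
    (trans (sym (*-identityˡ c)) (trans (cong (_* c) (sym ∣z∣²≡1))
      (trans (solve 4 (λ a b c d → (a :* a :+ b :* b) :* c := a :* (a :* c :- b :* d) :+ b :* (a :* d :+ b :* c)) refl a b c d)
        (trans (cong₂ (λ x y → a * x + b * y) (cong re zw≡-1) (cong im zw≡-1))
          (solve 2 (λ a b → a :* (:- con (pos 1)) :+ b :* (:- con (pos 0)) := :- a) refl a b)))))
    (trans (sym (*-identityˡ d)) (trans (cong (_* d) (sym ∣z∣²≡1))
      (trans (solve 4 (λ a b c d → (a :* a :+ b :* b) :* d := a :* (a :* d :+ b :* c) :- b :* (a :* c :- b :* d)) refl a b c d)
        (trans (cong₂ (λ x y → a * y - b * x) (cong re zw≡-1) (cong im zw≡-1))
          (solve 2 (λ a b → a :* (:- con (pos 0)) :- b :* (:- con (pos 1)) := b) refl a b)))))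

  exp-reflect : ∀ k → ∣ exp (i· (π / 2)) ∣² ≡ 1# → let u = exp (i· (π / suc (suc k))) in
    ∣ u ∣² ≡ 1# → exp (i· (fromℕ (suc k) * π / suc (suc k))) ≡ complex (- re u) (im u)
  exp-reflect k ∣v∣²≡1 ∣u∣²≡1 = trans (cong (λ x → exp (i· x)) (*-assoc _ _ _))
    (reflect _ _ ∣u∣²≡1 (trans (sym (exp-i-suc k t))
      (trans (cong (λ x → exp (i· x)) (fromℕ-*-/ (suc k))) (exp-iπ ∣v∣²≡1))))
    where
    t = π / suc (suc k)

-- Negative roots of cubics over ℂ.

module ComplexPolynomials (R : RealNumbers) where
  open RealNumbers R
  open SquareRoot R
  open Complex R
  open IntegerCoefficients R
  open Solver hiding (Polynomial)
  open OrderedField R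
  open ComplexAlgebra R
  open RawHyperfield ℂ-hyperfield using (⊞-sum)

  ⊞-sum⇒≡ : ∀ xs {z} → z ∈ ⊞-sum xs → foldr _+ℂ_ 0ℂ xs ≡ z
  ⊞-sum⇒≡ []       eq = eq
  ⊞-sum⇒≡ (x ∷ xs) (_ , b , refl , b∈xs , eq) = trans (cong (x +ℂ_) (⊞-sum⇒≡ xs b∈xs)) eq

  ≡⇒⊞-sum : ∀ xs {z} → foldr _+ℂ_ 0ℂ xs ≡ z → z ∈ ⊞-sum xs
  ≡⇒⊞-sum []       eq = eq
  ≡⇒⊞-sum (x ∷ xs) eq = x , _ , refl , ≡⇒⊞-sum xs refl , eq

  -- Division by T - x and evaluation at x, for x real, act separately on the
  -- real and on the imaginary parts of the coefficients.

  record Division (x : ℝ) (c : Fin 4 → ℝ) (d : Fin 3 → ℝ) : Set where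
    field
      c₀ : c (# 0) ≡ - x * d (# 0)
      c₁ : c (# 1) ≡ - x * d (# 1) + d (# 0)
      c₂ : c (# 2) ≡ - x * d (# 2) + d (# 1)
      c₃ : c (# 3) ≡ d (# 2)

  quadratic : (Fin 3 → ℝ) → ℝ → ℝ
  quadratic d x = d (# 0) + (d (# 1) * x + d (# 2) * (x * x))

  cubic : (Fin 4 → ℝ) → ℝ → ℝ
  cubic c x = c (# 0) + (c (# 1) * x + (c (# 2) * (x * x) + c (# 3) * (x * (x * x))))

  -- This and the next two are the sums to which the index pairs in `⊡` compute: (0,0), then (0,i)
  -- and (1,i-1), then (1,2), each closed by the `0ℂ` of the empty hypersum.
  constant-term : ∀ x z → (-ℂ ofℝ x) *ℂ z +ℂ 0ℂ ≡ complex (- x * re z) (- x * im z)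
  constant-term x (complex a b) = cong₂ complex
    (solve 3 (λ x a b → (:- x) :* a :- (:- con (pos 0)) :* b :+ con (pos 0) := (:- x) :* a) refl x a b)
    (solve 3 (λ x a b → (:- x) :* b :+ (:- con (pos 0)) :* a :+ con (pos 0) := (:- x) :* b) refl x a b)

  middle-term : ∀ x z w → (-ℂ ofℝ x) *ℂ z +ℂ (1ℂ *ℂ w +ℂ 0ℂ) ≡ complex (- x * re z + re w) (- x * im z + im w)
  middle-term x (complex a b) (complex c d) = cong₂ complex
    (solve 5 (λ x a b c d → (:- x) :* a :- (:- con (pos 0)) :* b
        :+ (con (pos 1) :* c :- con (pos 0) :* d :+ con (pos 0)) := (:- x) :* a :+ c) refl x a b c d)
    (solve 5 (λ x a b c d → (:- x) :* b :+ (:- con (pos 0)) :* a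
        :+ (con (pos 1) :* d :+ con (pos 0) :* c :+ con (pos 0)) := (:- x) :* b :+ d) refl x a b c d)

  leading-term : ∀ w → 1ℂ *ℂ w +ℂ 0ℂ ≡ w
  leading-term (complex c d) = cong₂ complex
    (solve 2 (λ c d → con (pos 1) :* c :- con (pos 0) :* d :+ con (pos 0) := c) refl c d)
    (solve 2 (λ c d → con (pos 1) :* d :+ con (pos 0) :* c :+ con (pos 0) := d) refl c d)

  *ℂ-ofℝ : ∀ z x → z *ℂ ofℝ x ≡ complex (re z * x) (im z * x)
  *ℂ-ofℝ (complex a b) x = cong₂ complex
    (solve 3 (λ a b x → a :* x :- b :* con (pos 0) := a :* x) refl a b x)
    (solve 3 (λ a b x → a :* con (pos 0) :+ b :* x := b :* x) refl a b x)

  ofℝ-*1 : ∀ x → ofℝ x *ℂ 1ℂ ≡ ofℝ x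
  ofℝ-*1 x = *ℂ-identityʳ (ofℝ x)

  ofℝ-* : ∀ x y → ofℝ x *ℂ ofℝ y ≡ ofℝ (x * y)
  ofℝ-* x y = trans (*ℂ-ofℝ (ofℝ x) y) (cong (complex (x * y)) (zeroˡ y))

  z+0 : ∀ z → z +ℂ 0ℂ ≡ z
  z+0 (complex a b) = cong₂ complex (+-identityʳ a) (+-identityʳ b)

  powers : ∀ x → ofℝ x *ℂ (ofℝ x *ℂ 1ℂ) ≡ ofℝ (x * x) × ofℝ x *ℂ (ofℝ x *ℂ (ofℝ x *ℂ 1ℂ)) ≡ ofℝ (x * (x * x))
  powers x = square , trans (cong (ofℝ x *ℂ_) square) (ofℝ-* x (x * x))
    where
    square = trans (cong (ofℝ x *ℂ_) (ofℝ-*1 x)) (ofℝ-* x x)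

  module _ (q : Polynomial ℂ-hyperfield 2) (x : ℝ) where
    private
      value-at : foldr _+ℂ_ 0ℂ (coeff q (# 0) *ℂ 1ℂ ∷ coeff q (# 1) *ℂ (ofℝ x *ℂ 1ℂ)
                   ∷ coeff q (# 2) *ℂ (ofℝ x *ℂ (ofℝ x *ℂ 1ℂ)) ∷ []) ≡
                 complex (quadratic (re ∘ coeff q) x) (quadratic (im ∘ coeff q) x)
      value-at = cong₂ _+ℂ_ (*ℂ-identityʳ _) (cong₂ _+ℂ_
        (trans (cong (coeff q (# 1) *ℂ_) (ofℝ-*1 x)) (*ℂ-ofℝ _ x))
        (trans (z+0 _) (trans (cong (coeff q (# 2) *ℂ_) (proj₁ (powers x))) (*ℂ-ofℝ _ (x * x)))))

    root⇒quadratic≡0 : Root (ofℝ x) q → quadratic (re ∘ coeff q) x ≡ 0# × quadratic (im ∘ coeff q) x ≡ 0#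
    root⇒quadratic≡0 root = cong re eq , cong im eq
      where
      eq = trans (sym value-at) (⊞-sum⇒≡ (_ ∷ _ ∷ _ ∷ []) root)

    quadratic≡0⇒root : quadratic (re ∘ coeff q) x ≡ 0# → quadratic (im ∘ coeff q) x ≡ 0# → Root (ofℝ x) q
    quadratic≡0⇒root p q = ≡⇒⊞-sum (_ ∷ _ ∷ _ ∷ []) (trans value-at (cong₂ complex p q))

  root⇒cubic≡0 : ∀ (p : Polynomial ℂ-hyperfield 3) x → Root (ofℝ x) p →
                 cubic (re ∘ coeff p) x ≡ 0# × cubic (im ∘ coeff p) x ≡ 0#
  root⇒cubic≡0 p x root = cong re eq , cong im eq
    where
    value-at : foldr _+ℂ_ 0ℂ (coeff p (# 0) *ℂ 1ℂ ∷ coeff p (# 1) *ℂ (ofℝ x *ℂ 1ℂ)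
                 ∷ coeff p (# 2) *ℂ (ofℝ x *ℂ (ofℝ x *ℂ 1ℂ))
                 ∷ coeff p (# 3) *ℂ (ofℝ x *ℂ (ofℝ x *ℂ (ofℝ x *ℂ 1ℂ))) ∷ []) ≡
               complex (cubic (re ∘ coeff p) x) (cubic (im ∘ coeff p) x)
    value-at = cong₂ _+ℂ_ (*ℂ-identityʳ _) (cong₂ _+ℂ_
      (trans (cong (coeff p (# 1) *ℂ_) (ofℝ-*1 x)) (*ℂ-ofℝ _ x))
      (cong₂ _+ℂ_ (trans (cong (coeff p (# 2) *ℂ_) (proj₁ (powers x))) (*ℂ-ofℝ _ (x * x)))
        (trans (z+0 _) (trans (cong (coeff p (# 3) *ℂ_) (proj₂ (powers x))) (*ℂ-ofℝ _ (x * (x * x)))))))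
    eq = trans (sym value-at) (⊞-sum⇒≡ (_ ∷ _ ∷ _ ∷ _ ∷ []) root)

  module _ (p : Polynomial ℂ-hyperfield 3) (q : Polynomial ℂ-hyperfield 2) (x : ℝ) where
    ⊡⇒division : _∈_⊡_ {n = 1} p (T- ofℝ x) q →
                 Division x (re ∘ coeff p) (re ∘ coeff q) × Division x (im ∘ coeff p) (im ∘ coeff q)
    ⊡⇒division h =
        record { c₀ = cong re e₀ ; c₁ = cong re e₁ ; c₂ = cong re e₂ ; c₃ = cong re e₃ }
      , record { c₀ = cong im e₀ ; c₁ = cong im e₁ ; c₂ = cong im e₂ ; c₃ = cong im e₃ }
      where
      e₀ = trans (sym (⊞-sum⇒≡ (_ ∷ []) (h (# 0)))) (constant-term x _)
      e₁ = trans (sym (⊞-sum⇒≡ (_ ∷ _ ∷ []) (h (# 1)))) (middle-term x _ _)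
      e₂ = trans (sym (⊞-sum⇒≡ (_ ∷ _ ∷ []) (h (# 2)))) (middle-term x _ _)
      e₃ = trans (sym (⊞-sum⇒≡ (_ ∷ []) (h (# 3)))) (leading-term _)

    division⇒⊡ : Division x (re ∘ coeff p) (re ∘ coeff q) → Division x (im ∘ coeff p) (im ∘ coeff q) →
                 _∈_⊡_ {n = 1} p (T- ofℝ x) q
    division⇒⊡ r i zero = ≡⇒⊞-sum (_ ∷ [])
      (trans (constant-term x _) (sym (cong₂ complex (Division.c₀ r) (Division.c₀ i))))
    division⇒⊡ r i (suc zero) = ≡⇒⊞-sum (_ ∷ _ ∷ [])
      (trans (middle-term x _ _) (sym (cong₂ complex (Division.c₁ r) (Division.c₁ i))))
    division⇒⊡ r i (suc (suc zero)) = ≡⇒⊞-sum (_ ∷ _ ∷ [])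
      (trans (middle-term x _ _) (sym (cong₂ complex (Division.c₂ r) (Division.c₂ i))))
    division⇒⊡ r i (suc (suc (suc zero))) = ≡⇒⊞-sum (_ ∷ [])
      (trans (leading-term _) (sym (cong₂ complex (Division.c₃ r) (Division.c₃ i))))

  cubic-division : ∀ {x c d} → Division x c d → ∀ y → cubic c y ≡ (y - x) * quadratic d y
  cubic-division {x} {c} {d} h y = trans
    (cong₂ _+_ (Division.c₀ h) (cong₂ _+_ (cong (_* y) (Division.c₁ h))
      (cong₂ _+_ (cong (_* (y * y)) (Division.c₂ h)) (cong (_* (y * (y * y))) (Division.c₃ h)))))
    (solve 5 (λ x y a b c → (:- x) :* a :+ (((:- x) :* b :+ a) :* y :+ (((:- x) :* c :+ b) :* (y :* y) :+ c :* (y :* (y :* y))))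
       := (y :- x) :* (a :+ (b :* y :+ c :* (y :* y)))) refl x y (d (# 0)) (d (# 1)) (d (# 2)))

  quotient : (p : Polynomial ℂ-hyperfield 3) (x : ℝ) → Root (ofℝ x) p →
             ∃[ q ] _∈_⊡_ {n = 1} p (T- ofℝ x) q
  quotient p x root = q , division⇒⊡ p q x
    (division (re ∘ coeff p) (proj₁ (root⇒cubic≡0 p x root)))
    (division (im ∘ coeff p) (proj₂ (root⇒cubic≡0 p x root)))
    where
    -- Synthetic division by T - x. Its remainder is `cubic c x`, so the vanishing at x enters only
    -- in `c₀`.
    horner : (Fin 4 → ℝ) → Fin 3 → ℝ
    horner c zero             = c (# 1) + x * (c (# 2) + x * c (# 3))
    horner c (suc zero)       = c (# 2) + x * c (# 3)
    horner c (suc (suc zero)) = c (# 3)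

    q : Polynomial ℂ-hyperfield 2
    q = record
      { coeff     = λ i → complex (horner (re ∘ coeff p) i) (horner (im ∘ coeff p) i)
      ; leading≢0 = leading≢0 p
      }

    division : ∀ c → cubic c x ≡ 0# → Division x c (horner c)
    division c eq = record
      { c₀ = trans (solve 5 (λ x a b c d → a := a :+ (b :* x :+ (c :* (x :* x) :+ d :* (x :* (x :* x))))
                      :+ (:- x) :* (b :+ x :* (c :+ x :* d))) refl x (c (# 0)) (c (# 1)) (c (# 2)) (c (# 3)))
                   (trans (cong (_+ - x * horner c (# 0)) eq) (+-identityˡ _))
      ; c₁ = solve 3 (λ x a b → a := (:- x) :* b :+ (a :+ x :* b)) refl x (c (# 1)) (c (# 2) + x * c (# 3))
      ; c₂ = solve 3 (λ x a b → a := (:- x) :* b :+ (a :+ x :* b)) refl x (c (# 2)) (c (# 3))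
      ; c₃ = refl
      }

  -- The relations imposed by the phases 1, a + b i, i and - a + b i, with the
  -- moduli replaced by arbitrary real factors.

  record Shape (a b : ℝ) (p : Polynomial ℂ-hyperfield 3) : Set where
    field
      r₀ r₂   : ℝ
      im-c₃≡0 : im (coeff p (# 3)) ≡ 0#
      c₂≡     : coeff p (# 2) ≡ r₂ • complex a b
      re-c₁≡0 : re (coeff p (# 1)) ≡ 0#
      c₀≡     : coeff p (# 0) ≡ r₀ • complex (- a) b

  module Roots {a b : ℝ} (b≢0 : b ≢ 0#) (p : Polynomial ℂ-hyperfield 3) (shape : Shape a b p) where
    open Shape shape

    r₃ = re (coeff p (# 3))

    r₃≢0 : r₃ ≢ 0#
    r₃≢0 r₃≡0 = leading≢0 p (cong₂ complex r₃≡0 im-c₃≡0)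

    -- With k = r₂ a, comparing coefficients in p = (T - x)(T - y)(r₃ T + z) gives
    -- 2 k + (x + y) r₃ = 0 and y k = x (k + x r₃), hence (x² + y²) r₃ = 0.

    no-two-negative-roots : ∀ q {x y} → _∈_⊡_ {n = 1} p (T- ofℝ x) q → Root (ofℝ y) q → x < 0# → y < 0# → ⊥
    no-two-negative-roots q {x} {y} p∈ root x<0 y<0 = x²+y²≢0 (*-cancelˡ r₃≢0 (trans r₃[x²+y²]≡0 (sym (zeroʳ r₃))))
      where
      module Re = Division (proj₁ (⊡⇒division p q x p∈))
      module Im = Division (proj₂ (⊡⇒division p q x p∈))
      Q = re ∘ coeff q
      Q′ = im ∘ coeff q
      k = r₂ * a

      x≢0 : x ≢ 0#
      x≢0 = proj₂ x<0

      x²+y²≢0 : x * x + y * y ≢ 0#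
      x²+y²≢0 eq = *-≢0 x≢0 x≢0 (+-≡0 (square-nonneg x) (square-nonneg y) eq)

      -- The imaginary part of q is linear and vanishes at y, so it is r₂ b (T - y). Multiplying by
      -- -x in the constant term and cancelling b gives r₀ = x y r₂, which carries the information
      -- over to the real parts.
      Q′₂≡0 : Q′ (# 2) ≡ 0#
      Q′₂≡0 = trans (sym Im.c₃) im-c₃≡0

      Q′₁≡r₂b : Q′ (# 1) ≡ r₂ * b
      Q′₁≡r₂b = trans (solve 2 (λ x c → c := (:- x) :* con (pos 0) :+ c) refl x (Q′ (# 1)))
        (trans (cong (λ z → - x * z + Q′ (# 1)) (sym Q′₂≡0)) (trans (sym Im.c₂) (cong im c₂≡)))

      Q′₀≡ : Q′ (# 0) ≡ - (r₂ * b * y)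
      Q′₀≡ = trans (solve 3 (λ c d y → c := (c :+ (d :* y :+ con (pos 0) :* (y :* y))) :- d :* y) refl (Q′ (# 0)) (Q′ (# 1)) y)
        (trans (cong₂ (λ u v → Q′ (# 0) + (Q′ (# 1) * y + u * (y * y)) - v * y) (sym Q′₂≡0) Q′₁≡r₂b)
        (trans (cong (λ u → u - r₂ * b * y) (proj₂ (root⇒quadratic≡0 q y root))) (+-identityˡ _)))

      r₀≡ : r₀ ≡ x * (y * r₂)
      r₀≡ = *-cancelˡ b≢0 (trans (*-comm b r₀) (trans (trans (sym (cong im c₀≡)) (trans Im.c₀ (cong (- x *_) Q′₀≡)))
        (solve 4 (λ x y r b → (:- x) :* (:- (r :* b :* y)) := b :* (x :* (y :* r))) refl x y r₂ b)))

      Q₀≡ : Q (# 0) ≡ y * k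
      Q₀≡ = *-cancelˡ x≢0 (trans (solve 2 (λ x c → x :* c := :- ((:- x) :* c)) refl x (Q (# 0)))
        (trans (cong -_ (trans (sym Re.c₀) (trans (cong re c₀≡) (cong (_* - a) r₀≡))))
        (solve 4 (λ x y r a → :- (x :* (y :* r) :* (:- a)) := x :* (y :* (r :* a))) refl x y r₂ a)))

      Q₁≡ : Q (# 1) ≡ k + x * r₃
      Q₁≡ = trans (solve 3 (λ x c d → d := ((:- x) :* c :+ d) :+ x :* c) refl x (Q (# 2)) (Q (# 1)))
        (cong₂ (λ u v → u + x * v) (trans (sym Re.c₂) (cong re c₂≡)) (sym Re.c₃))

      -- The real part of q(y) = 0, divided by y.
      h₁ : k + k + (x + y) * r₃ ≡ 0#
      h₁ = *-cancelˡ (proj₂ y<0) (trans (solve 4 (λ x y k r → y :* (k :+ k :+ (x :+ y) :* r)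
             := y :* k :+ ((k :+ x :* r) :* y :+ r :* (y :* y))) refl x y k r₃)
        (trans (cong₂ _+_ (sym Q₀≡) (cong₂ _+_ (cong (_* y) (sym Q₁≡)) (cong (_* (y * y)) Re.c₃)))
        (trans (proj₁ (root⇒quadratic≡0 q y root)) (sym (zeroʳ y)))))

      h₂ : y * k ≡ x * (k + x * r₃)
      h₂ = trans (sym Q₀≡) (trans
        (solve 3 (λ x c d → c := ((:- x) :* d :+ c) :+ x :* d) refl x (Q (# 0)) (Q (# 1)))
        (trans (cong₂ _+_ (trans (sym Re.c₁) re-c₁≡0) (cong (x *_) Q₁≡)) (+-identityˡ _)))

      r₃[x²+y²]≡0 : r₃ * (x * x + y * y) ≡ 0#
      r₃[x²+y²]≡0 = trans
        (solve 4 (λ x y k r → r :* (x :* x :+ y :* y) :=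
            (y :- x) :* (k :+ k :+ (x :+ y) :* r) :- (y :* k :- x :* (k :+ x :* r)) :- (y :* k :- x :* (k :+ x :* r)))
          refl x y k r₃)
        (trans (cong₂ (λ u v → (y - x) * u - (v - w) - (v - w)) h₁ h₂)
          (solve 2 (λ z w → z :* con (pos 0) :- (w :- w) :- (w :- w) := con (pos 0)) refl (y - x) w))
        where
        w = x * (k + x * r₃)

    -- By p(y) = (y - x) q(y), a second root y ≠ x is a root of the quotient q, which is already
    -- excluded.
    negative-root-unique : ∀ {x y} → x < 0# → y < 0# → Root (ofℝ x) p → Root (ofℝ y) p → x ≡ y
    negative-root-unique {x} {y} x<0 y<0 x-root y-root with x ≟ y
    ... | yes x≡y = x≡y
    ... | no  x≢y = ⊥-elim (no-two-negative-roots (proj₁ quot) (proj₂ quot)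
            (quadratic≡0⇒root (proj₁ quot) y
              (zero-at-y (proj₁ div) (proj₁ (root⇒cubic≡0 p y y-root)))
              (zero-at-y (proj₂ div) (proj₂ (root⇒cubic≡0 p y y-root)))) x<0 y<0)
      where
      quot = quotient p x x-root
      div = ⊡⇒division p (proj₁ quot) x (proj₂ quot)
      y-x≢0 : y - x ≢ 0#
      y-x≢0 eq = x≢y (trans (sym (+-identityʳ x)) (trans (cong (x +_) (sym eq))
        (solve 2 (λ x y → x :+ (y :- x) := y) refl x y)))
      zero-at-y : ∀ {c d} → Division x c d → cubic c y ≡ 0# → quadratic d y ≡ 0#
      zero-at-y h eq = *-cancelˡ y-x≢0 (trans (sym (cubic-division h y)) (trans eq (sym (zeroʳ _))))

    -- The case of a double root: positive multiplicity in a quotient would make x a root twice.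
    quotient-mult≡0 : ∀ {x k} → x < 0# → k ∈ QuotientMult (ofℝ x) p → k ≡ 0
    quotient-mult≡0 x<0 (q , p∈ , inj₁ (_ , k≡0))  = k≡0
    quotient-mult≡0 x<0 (q , p∈ , inj₂ (root , _)) = ⊥-elim (no-two-negative-roots q p∈ root x<0 x<0)

    negative-root⇒mult≡1 : ∀ {x} → x < 0# → Root (ofℝ x) p → Mult (ofℝ x) p 1
    negative-root⇒mult≡1 {x} x<0 root = inj₂ (root , 0 , refl
      , (proj₁ quot , proj₂ quot , inj₁ ((λ root′ → no-two-negative-roots (proj₁ quot) (proj₂ quot) root′ x<0 x<0) , refl))
      , ℕ.≤-reflexive ∘ quotient-mult≡0 x<0)
      where
      quot = quotient p x root

    IsNegative : Pred ℂ 0ℓ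
    IsNegative z = ∃[ x ] x < 0# × z ≡ ofℝ x

    mult-of-nonroot : ∀ {z m} → ¬ Root z p → Mult z p m → m ≡ 0
    mult-of-nonroot ¬root (inj₁ (_ , m≡0))  = m≡0
    mult-of-nonroot ¬root (inj₂ (root , _)) = ⊥-elim (¬root root)

    -- Lists may contain nonroots, which add 0. The first root in the list adds 1, and since the
    -- entries are distinct and the negative root is unique, everything after it adds 0. Arbitrary
    -- lists are treated because equality has to be refuted for every possible witness of the sum.
    mult-sum≤1 : ∀ ams → Unique (map proj₁ ams) → All (λ (z , m) → IsNegative z × Mult z p m) ams →
                 sum (map proj₂ ams) ℕ.≤ 1
    mult-sum≤1 [] _ _ = z≤n
    mult-sum≤1 ((_ , m) ∷ ams) (z∉ ∷ unique) ((_ , inj₁ (_ , refl)) ∷ mults) = mult-sum≤1 ams unique mults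
    mult-sum≤1 ((_ , m) ∷ ams) (z∉ ∷ unique) (((x , x<0 , refl) , inj₂ (root , k , refl , k∈ , _)) ∷ mults) =
      ℕ.≤-reflexive (cong₂ (λ u v → suc u ℕ.+ v) (quotient-mult≡0 x<0 k∈) (rest ams z∉ mults))
      where
      rest : ∀ bms → All (ofℝ x ≢_) (map proj₁ bms) → All (λ (z , m) → IsNegative z × Mult z p m) bms →
             sum (map proj₂ bms) ≡ 0
      rest [] _ _ = refl
      rest ((_ , n) ∷ bms) (x≢y ∷ x∉) (((y , y<0 , refl) , mult) ∷ mults) = cong₂ ℕ._+_
        (mult-of-nonroot (x≢y ∘ cong ofℝ ∘ negative-root-unique x<0 y<0 root) mult) (rest bms x∉ mults)

    -- A witness list has to be produced, and excluded middle decides whether it is empty or holds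
    -- the one negative root.
    negative-mult-sum : ExcludedMiddle 0ℓ → ∃[ s ] MultSum IsNegative p s × s ℕ.< 2
    negative-mult-sum em with em {∃[ x ] x < 0# × Root (ofℝ x) p}
    ... | no  no-root = 0 , ([] , [] , [] , (λ { _ (x , x<0 , refl) _ → inj₁ ((λ root → no-root (x , x<0 , root)) , refl) }) , refl)
                      , s≤s z≤n
    ... | yes (x , x<0 , root) = 1
        , ( (ofℝ x , 1) ∷ [] , [] ∷ [] , ((x , x<0 , refl) , negative-root⇒mult≡1 x<0 root) ∷ []
          , (λ { _ (y , y<0 , refl) y∉ → inj₁ ((λ root′ →
                 y∉ (here (cong ofℝ (negative-root-unique y<0 x<0 root′ root)))) , refl) })
          , refl)
        , s≤s (s≤s z≤n)

-- Hypersums of phases and the multiplicity over ℙ.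

module PhaseHyperfield (R : RealNumbers) where
  open RealNumbers R
  open SquareRoot R
  open Complex R
  open ModulusProperties
  open IntegerCoefficients R
  open Solver hiding (Polynomial)
  open OrderedField R
  open ComplexAlgebra R
  open RawHyperfield ℙ using (⊞-sum)

  phase-ext : ∀ {x y} → value x ≡ value y → x ≡ y
  phase-ext {phase _ _} {phase _ _} refl = refl

  -- The field is irrelevant, but equality of reals is decidable, so the alternative can be
  -- recomputed.
  isPhase′ : ∀ x → IsPhase (value x)
  isPhase′ (phase z h) = recompute ((z ≟ℂ 0ℂ) ⊎-dec (∣ z ∣ ≟ 1#)) h

  unit : ∀ x → value x ≢ 0ℂ → ∣ value x ∣² ≡ 1#
  unit x x≢0 with isPhase′ x
  ... | inj₁ x≡0   = ⊥-elim (x≢0 x≡0)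
  ... | inj₂ ∣x∣≡1 = ∣∣≡1⇒∣∣²≡1 (value x) ∣x∣≡1

  nonneg-square-injective : ∀ {x y} → 0# ≤ x → 0# ≤ y → x * x ≡ y * y → x ≡ y
  nonneg-square-injective 0≤x 0≤y eq = ≤-antisym
    (0≤y-x⇒x≤y (upper (square-≤⇒∈± 0≤y (≤-reflexive eq))))
    (0≤y-x⇒x≤y (upper (square-≤⇒∈± 0≤x (≤-reflexive (sym eq)))))

  normalize-• : ∀ {r} z → 0# < r → ∣ z ∣² ≡ 1# → normalize (r • z) ≡ z
  normalize-• {r} z 0<r ∣z∣²≡1 = cong₂ complex (cancel (re z)) (cancel (im z))
    where
    ∣rz∣≡r : ∣ r • z ∣ ≡ r
    ∣rz∣≡r = nonneg-square-injective (∣∣-nonneg (r • z)) (proj₁ 0<r)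
      (trans (∣∣*∣∣ (r • z)) (trans (∣•∣² r z) (trans (cong (r * r *_) ∣z∣²≡1) (*-identityʳ _))))
    cancel : ∀ x → ∣ r • z ∣ ⁻¹ * (r * x) ≡ x
    cancel x = trans (cong (λ s → s ⁻¹ * (r * x)) ∣rz∣≡r)
      (trans (sym (*-assoc _ _ _)) (trans (cong (_* x) (*-inverseˡ (pos⇒≢0 0<r))) (*-identityˡ x)))

  -- The imaginary part of z̄ w, the oriented area. When it is nonzero, z and w are independent over
  -- ℝ, which leaves only the `arc` case of the hypersum.
  cross : ℂ → ℂ → ℝ
  cross z w = re z * im w - im z * re w

  cross-combination : ∀ z w α β → cross z (α • z +ℂ β • w) ≡ β * cross z w
  cross-combination (complex a b) (complex c d) α β = solve 6 (λ a b c d α β →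
    a :* (α :* b :+ β :* d) :- b :* (α :* a :+ β :* c) := β :* (a :* d :- b :* c)) refl a b c d α β

  cross-zeroˡ : ∀ w → cross 0ℂ w ≡ 0#
  cross-zeroˡ (complex c d) = solve 2 (λ c d → con (pos 0) :* d :- con (pos 0) :* c := con (pos 0)) refl c d

  cross-zeroʳ : ∀ z → cross z 0ℂ ≡ 0#
  cross-zeroʳ (complex a b) = solve 2 (λ a b → a :* con (pos 0) :- b :* con (pos 0) := con (pos 0)) refl a b

  cross-neg : ∀ z → cross z (-ℂ z) ≡ 0#
  cross-neg (complex a b) = solve 2 (λ a b → a :* (:- b) :- b :* (:- a) := con (pos 0)) refl a b

  module _ {x y : Phase} (x×y≢0 : cross (value x) (value y) ≢ 0#) where
    x≢0 : x ≢ 0ℙ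
    x≢0 refl = x×y≢0 (cross-zeroˡ (value y))

    y≢0 : y ≢ 0ℙ
    y≢0 refl = x×y≢0 (cross-zeroʳ (value x))

    y≢-x : y ≢ -ℙ x
    y≢-x refl = x×y≢0 (cross-neg (value x))

    combination≢0 : ∀ α {β} → 0# < β → α • value x +ℂ β • value y ≢ 0ℂ
    combination≢0 α {β} 0<β eq = *-≢0 (pos⇒≢0 0<β) x×y≢0 (trans
      (sym (cross-combination (value x) (value y) α β)) (trans (cong (cross (value x)) eq) (cross-zeroʳ (value x))))

    -- A positive linear relation suffices: normalising both sides removes the factor r, since z has
    -- modulus 1. Memberships thus become polynomial identities.
    combination⇒∈⊞ : ∀ {z} r α β → 0# < r → 0# < α → 0# < β →
      r • value z ≡ α • value x +ℂ β • value y → z ∈ x ⊞ℙ y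
    combination⇒∈⊞ {z} r α β 0<r 0<α 0<β eq = arc α β x≢0 y≢0 y≢-x 0<α 0<β
      (trans (sym (normalize-• (value z) 0<r (unit z z≢0))) (cong normalize eq))
      where
      z≢0 : value z ≢ 0ℂ
      z≢0 z≡0 = combination≢0 α 0<β (trans (sym eq) (trans (cong (r •_) z≡0) (cong₂ complex (zeroʳ r) (zeroʳ r))))

    0∉⊞ : ¬ 0ℙ ∈ x ⊞ℙ y
    0∉⊞ h = absurd h refl
      where
      absurd : ∀ {z} → z ∈ x ⊞ℙ y → z ≢ 0ℙ
      absurd (zero+ x≡0)      _   = x≢0 x≡0
      absurd (+zero y≡0)      _   = y≢0 y≡0
      absurd (opposite y≡-x _) _  = y≢-x y≡-x
      absurd (arc α β _ _ _ _ 0<β eq) refl = 1≢0 (trans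
        (sym (∣∣≡1⇒∣∣²≡1 _ (∣normalize∣≡1 _ (combination≢0 α 0<β)))) (trans (cong ∣_∣² (sym eq)) ∣0∣²≡0))

  ∈-single : ∀ {x y} → x ≡ y → y ∈ ⊞-sum (x ∷ [])
  ∈-single refl = _ , 0ℙ , refl , refl , +zero refl

  ∈-cons : ∀ {x x′ y z} xs → x ≡ x′ → z ∈ x′ ⊞ℙ y → y ∈ ⊞-sum xs → z ∈ ⊞-sum (x ∷ xs)
  ∈-cons _ refl z∈ y∈ = _ , _ , refl , y∈ , z∈

  -- Adding `0ℙ` is single-valued even through `opposite`, where 0 = -x forces x = 0.
  single⇒≡ : ∀ {x z} → z ∈ ⊞-sum (x ∷ []) → x ≡ z
  single⇒≡ {x} (_ , _ , refl , refl , z∈) = sum-with-zero z∈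
    where
    sum-with-zero : ∀ {z} → z ∈ x ⊞ℙ 0ℙ → x ≡ z
    sum-with-zero (zero+ x≡0) = x≡0
    sum-with-zero (+zero _)   = refl
    sum-with-zero (arc _ _ _ 0≢0 _ _ _ _) = ⊥-elim (0≢0 refl)
    sum-with-zero (opposite 0≡-x z∈) = cases z∈
      where
      neg-zero : ∀ w → 0ℂ ≡ -ℂ w → w ≡ 0ℂ
      neg-zero (complex a b) eq = cong₂ complex (component a (cong re eq)) (component b (cong im eq))
        where
        component : ∀ c → 0# ≡ - c → c ≡ 0#
        component c eq = trans (solve 1 (λ c → c := :- (:- c)) refl c)
          (trans (cong -_ (sym eq)) (solve 0 (:- con (pos 0) := con (pos 0)) refl))
      x≡0 : x ≡ 0ℙ
      x≡0 = phase-ext (neg-zero (value x) (cong value 0≡-x))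
      cases : ∀ {z} → z ≡ 0ℙ ⊎ z ≡ x ⊎ z ≡ -ℙ x → x ≡ z
      cases (inj₁ z≡0)         = trans x≡0 (sym z≡0)
      cases (inj₂ (inj₁ z≡x))  = sym z≡x
      cases (inj₂ (inj₂ z≡-x)) = trans x≡0 (trans 0≡-x (sym z≡-x))

  1*ℙ : ∀ x → 1ℙ *ℙ x ≡ x
  1*ℙ x = phase-ext (*ℂ-identityˡ (value x))

  *ℙ1 : ∀ x → x *ℙ 1ℙ ≡ x
  *ℙ1 x = phase-ext (*ℂ-identityʳ (value x))

  -1*ℙ : ∀ x → (-ℙ 1ℙ) *ℙ x ≡ -ℙ x
  -1*ℙ x = phase-ext (lemma (value x))
    where
    lemma : ∀ z → (-ℂ 1ℂ) *ℂ z ≡ -ℂ z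
    lemma (complex a b) = cong₂ complex
      (solve 2 (λ a b → (:- con (pos 1)) :* a :- (:- con (pos 0)) :* b := :- a) refl a b)
      (solve 2 (λ a b → (:- con (pos 1)) :* b :+ (:- con (pos 0)) :* a := :- b) refl a b)

  *ℙ-1 : ∀ x → x *ℙ (-ℙ 1ℙ) ≡ -ℙ x
  *ℙ-1 x = phase-ext (lemma (value x))
    where
    lemma : ∀ z → z *ℂ (-ℂ 1ℂ) ≡ -ℂ z
    lemma (complex a b) = cong₂ complex
      (solve 2 (λ a b → a :* (:- con (pos 1)) :- b :* (:- con (pos 0)) := :- a) refl a b)
      (solve 2 (λ a b → a :* (:- con (pos 0)) :+ b :* (:- con (pos 1)) := :- b) refl a b)

  neg²ℙ : ∀ x → -ℙ -ℙ x ≡ x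
  neg²ℙ x = phase-ext (cong₂ complex (neg-neg (re (value x))) (neg-neg (im (value x))))
    where
    neg-neg : ∀ a → - - a ≡ a
    neg-neg = solve 1 (λ a → :- (:- a) := a) refl

  -- The constant coefficient of T - (-1) is literally a double negation.
  neg²1*ℙ : ∀ x → (-ℙ -ℙ 1ℙ) *ℙ x ≡ x
  neg²1*ℙ x = trans (cong (_*ℙ x) (neg²ℙ 1ℙ)) (1*ℙ x)

  module _ where
    open RawHyperfield ℙ using (_^_)

    *-1^1 : ∀ x → x *ℙ ((-ℙ 1ℙ) ^ 1) ≡ -ℙ x
    *-1^1 x = trans (cong (x *ℙ_) (*ℙ1 (-ℙ 1ℙ))) (*ℙ-1 x)

    -1^2 : (-ℙ 1ℙ) ^ 2 ≡ 1ℙ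
    -1^2 = trans (*-1^1 (-ℙ 1ℙ)) (neg²ℙ 1ℙ)

    *-1^2 : ∀ x → x *ℙ ((-ℙ 1ℙ) ^ 2) ≡ x
    *-1^2 x = trans (cong (x *ℙ_) -1^2) (*ℙ1 x)

    *-1^3 : ∀ x → x *ℙ ((-ℙ 1ℙ) ^ 3) ≡ -ℙ x
    *-1^3 x = trans (cong (x *ℙ_) (*-1^2 (-ℙ 1ℙ))) (*ℙ-1 x)

  -- The polynomial T³ + u T² + i T - ū for a unit u = a + b i in the open first quadrant.

  module Cubic {a b : ℝ} (0<a : 0# < a) (0<b : 0# < b) (a²+b²≡1 : a * a + b * b ≡ 1#)
               (p̄ : Polynomial ℙ 3)
               (c₃ : value (coeff p̄ (# 3)) ≡ 1ℂ) (c₂ : value (coeff p̄ (# 2)) ≡ complex a b)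
               (c₁ : value (coeff p̄ (# 1)) ≡ i· 1#) (c₀ : value (coeff p̄ (# 0)) ≡ complex (- a) b) where

    -1ℙ : Phase
    -1ℙ = -ℙ 1ℙ

    u i w : Phase
    u = phase (complex a b) (inj₂ (∣∣²≡1⇒∣∣≡1 _ a²+b²≡1))
    i = phase (i· 1#) (inj₂ (∣∣²≡1⇒∣∣≡1 _ (solve 0 (con (pos 0) :* con (pos 0) :+ con (pos 1) :* con (pos 1) := con (pos 1)) refl)))
    w = phase (complex (- a) b) (inj₂ (∣∣²≡1⇒∣∣≡1 _ (trans (cong (_+ b * b) (square-neg a)) a²+b²≡1)))

    0<b+1 : 0# < b + 1#
    0<b+1 = +-pos 0<b 0≤1

    u+i : ℂ
    u+i = complex a (b + 1#)

    u+i≢0 : u+i ≢ 0ℂ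
    u+i≢0 eq = pos⇒≢0 0<a (cong re eq)

    ν : ℝ
    ν = ∣ u+i ∣ ⁻¹

    0<ν : 0# < ν
    0<ν = ⁻¹-pos (∣∣-nonneg u+i , λ 0≡∣u+i∣ → u+i≢0 (∣∣²≡0⇒≡0 u+i
      (trans (sym (∣∣*∣∣ u+i)) (trans (cong (_* ∣ u+i ∣) (sym 0≡∣u+i∣)) (zeroˡ ∣ u+i ∣)))))

    -- For arguments between 0 and π, u in the arc from 1 to d and i in the arc from d to w mean
    -- that d lies strictly between u and i. The direction of u + i does, and keeps the coefficients
    -- below polynomial in ν, a and b.
    d : Phase
    d = phase (normalize u+i) (inj₂ (∣normalize∣≡1 u+i u+i≢0))

    ≡pos⇒≢0 : ∀ {x y} → 0# < y → x ≡ y → x ≢ 0#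
    ≡pos⇒≢0 0<y refl = pos⇒≢0 0<y

    0<ν[b+1] : 0# < ν * (b + 1#)
    0<ν[b+1] = *-pos 0<ν 0<b+1

    0<νa : 0# < ν * a
    0<νa = *-pos 0<ν 0<a

    0<b+[b+1] : 0# < b + (b + 1#)
    0<b+[b+1] = +-pos 0<b (proj₁ 0<b+1)

    -- With d = ν(u + i), this and the next two memberships rest on ν(b+1) u = νa + b d, ν(2b+1) i =
    -- d + ν w and b d = νa(2b+1) + ν(b+1) w.
    u∈1⊞d : u ∈ 1ℙ ⊞ℙ d
    u∈1⊞d = combination⇒∈⊞
      (≡pos⇒≢0 0<ν[b+1] (solve 3 (λ n a b → con (pos 1) :* (n :* (b :+ con (pos 1))) :- con (pos 0) :* (n :* a)
         := n :* (b :+ con (pos 1))) refl ν a b))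
      (ν * (b + 1#)) (ν * a) b 0<ν[b+1] 0<νa 0<b
      (cong₂ complex
        (solve 3 (λ n a b → n :* (b :+ con (pos 1)) :* a := n :* a :* con (pos 1) :+ b :* (n :* a)) refl ν a b)
        (solve 3 (λ n a b → n :* (b :+ con (pos 1)) :* b := n :* a :* con (pos 0) :+ b :* (n :* (b :+ con (pos 1)))) refl ν a b))

    i∈d⊞w : i ∈ d ⊞ℙ w
    i∈d⊞w = combination⇒∈⊞
      (≡pos⇒≢0 (*-pos 0<νa 0<b+[b+1])
        (solve 3 (λ n a b → n :* a :* b :- n :* (b :+ con (pos 1)) :* (:- a) := n :* a :* (b :+ (b :+ con (pos 1)))) refl ν a b))
      (ν * (b + (b + 1#))) 1# ν (*-pos 0<ν 0<b+[b+1]) 0<1 0<ν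
      (cong₂ complex
        (solve 3 (λ n a b → n :* (b :+ (b :+ con (pos 1))) :* con (pos 0) := con (pos 1) :* (n :* a) :+ n :* (:- a)) refl ν a b)
        (solve 3 (λ n a b → n :* (b :+ (b :+ con (pos 1))) :* con (pos 1) := con (pos 1) :* (n :* (b :+ con (pos 1))) :+ n :* b) refl ν a b))

    d∈1⊞w : d ∈ 1ℙ ⊞ℙ w
    d∈1⊞w = combination⇒∈⊞
      (≡pos⇒≢0 0<b (solve 2 (λ a b → con (pos 1) :* b :- con (pos 0) :* (:- a) := b) refl a b))
      b (ν * a * (b + (b + 1#))) (ν * (b + 1#)) 0<b (*-pos 0<νa 0<b+[b+1]) 0<ν[b+1]
      (cong₂ complex
        (solve 3 (λ n a b → b :* (n :* a) := n :* a :* (b :+ (b :+ con (pos 1))) :* con (pos 1) :+ n :* (b :+ con (pos 1)) :* (:- a)) refl ν a b)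
        (solve 3 (λ n a b → b :* (n :* (b :+ con (pos 1))) := n :* a :* (b :+ (b :+ con (pos 1))) :* con (pos 0) :+ n :* (b :+ con (pos 1)) :* b) refl ν a b))

    -- The same three relations with terms moved across the equality, now for evaluating the
    -- polynomials at -1; all coefficients stay positive once the signs go to the phases.
    d∈u⊞-1 : d ∈ u ⊞ℙ -1ℙ
    d∈u⊞-1 = combination⇒∈⊞
      (≡pos⇒≢0 0<b (solve 2 (λ a b → a :* (:- con (pos 0)) :- b :* (:- con (pos 1)) := b) refl a b))
      b (ν * (b + 1#)) (ν * a) 0<b 0<ν[b+1] 0<νa
      (cong₂ complex
        (solve 3 (λ n a b → b :* (n :* a) := n :* (b :+ con (pos 1)) :* a :+ n :* a :* (:- con (pos 1))) refl ν a b)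
        (solve 3 (λ n a b → b :* (n :* (b :+ con (pos 1))) := n :* (b :+ con (pos 1)) :* b :+ n :* a :* (:- con (pos 0))) refl ν a b))

    -w∈-i⊞d : (-ℙ w) ∈ (-ℙ i) ⊞ℙ d
    -w∈-i⊞d = combination⇒∈⊞
      (≡pos⇒≢0 0<νa (solve 3 (λ n a b → (:- con (pos 0)) :* (n :* (b :+ con (pos 1))) :- (:- con (pos 1)) :* (n :* a) := n :* a) refl ν a b))
      ν (ν * (b + (b + 1#))) 1# 0<ν (*-pos 0<ν 0<b+[b+1]) 0<1
      (cong₂ complex
        (solve 3 (λ n a b → n :* (:- (:- a)) := n :* (b :+ (b :+ con (pos 1))) :* (:- con (pos 0)) :+ con (pos 1) :* (n :* a)) refl ν a b)
        (solve 3 (λ n a b → n :* (:- b) := n :* (b :+ (b :+ con (pos 1))) :* (:- con (pos 1)) :+ con (pos 1) :* (n :* (b :+ con (pos 1)))) refl ν a b))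

    -w∈-d⊞1 : (-ℙ w) ∈ (-ℙ d) ⊞ℙ 1ℙ
    -w∈-d⊞1 = combination⇒∈⊞
      (≡pos⇒≢0 0<ν[b+1] (solve 3 (λ n a b → (:- (n :* a)) :* con (pos 0) :- (:- (n :* (b :+ con (pos 1)))) :* con (pos 1)
         := n :* (b :+ con (pos 1))) refl ν a b))
      (ν * (b + 1#)) b (ν * a * (b + (b + 1#))) 0<ν[b+1] 0<b (*-pos 0<νa 0<b+[b+1])
      (cong₂ complex
        (solve 3 (λ n a b → n :* (b :+ con (pos 1)) :* (:- (:- a)) := b :* (:- (n :* a)) :+ n :* a :* (b :+ (b :+ con (pos 1))) :* con (pos 1)) refl ν a b)
        (solve 3 (λ n a b → n :* (b :+ con (pos 1)) :* (:- b) := b :* (:- (n :* (b :+ con (pos 1)))) :+ n :* a :* (b :+ (b :+ con (pos 1))) :* con (pos 0)) refl ν a b))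

    0∉w⊞-1 : ¬ 0ℙ ∈ w ⊞ℙ -1ℙ
    0∉w⊞-1 = 0∉⊞ (≡pos⇒≢0 0<b
      (solve 2 (λ a b → (:- a) :* (:- con (pos 0)) :- b :* (:- con (pos 1)) := b) refl a b))

    0∈w⊞-w : 0ℙ ∈ w ⊞ℙ (-ℙ w)
    0∈w⊞-w = opposite refl (inj₁ refl)

    p̄₀≡w : coeff p̄ (# 0) ≡ w
    p̄₀≡w = phase-ext c₀

    p̄₁≡i : coeff p̄ (# 1) ≡ i
    p̄₁≡i = phase-ext c₁

    p̄₂≡u : coeff p̄ (# 2) ≡ u
    p̄₂≡u = phase-ext c₂

    p̄₃≡1 : coeff p̄ (# 3) ≡ 1ℙ
    p̄₃≡1 = phase-ext c₃

    q : Polynomial ℙ 2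
    q = record
      { coeff     = λ { zero → w ; (suc zero) → d ; (suc (suc zero)) → 1ℙ }
      ; leading≢0 = RawHyperfield.1≢0 ℙ
      }

    r : Polynomial ℙ 1
    r = record
      { coeff     = λ { zero → w ; (suc zero) → 1ℙ }
      ; leading≢0 = RawHyperfield.1≢0 ℙ
      }

    root-p̄ : Root -1ℙ p̄
    -- The partial hypersums, from the leading term down, are chosen as -1, d, -w and 0.
    root-p̄ = ∈-cons (_ ∷ _ ∷ _ ∷ []) (trans (*ℙ1 (coeff p̄ (# 0))) p̄₀≡w) 0∈w⊞-w
      (∈-cons (_ ∷ _ ∷ []) (trans (*-1^1 (coeff p̄ (# 1))) (cong -ℙ_ p̄₁≡i)) -w∈-i⊞d
      (∈-cons (_ ∷ []) (trans (*-1^2 (coeff p̄ (# 2))) p̄₂≡u) d∈u⊞-1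
      (∈-single (trans (*-1^3 (coeff p̄ (# 3))) (cong -ℙ_ p̄₃≡1)))))

    root-q : Root -1ℙ q
    root-q = ∈-cons (_ ∷ _ ∷ []) (*ℙ1 w) 0∈w⊞-w (∈-cons (_ ∷ []) (*-1^1 d) -w∈-d⊞1 (∈-single (*-1^2 1ℙ)))

    p̄∈[T+1]⊡q : _∈_⊡_ {n = 1} p̄ (T- -1ℙ) q
    p̄∈[T+1]⊡q zero                   = ∈-single (trans (neg²1*ℙ w) (sym p̄₀≡w))
    p̄∈[T+1]⊡q (suc zero)             = ∈-cons (_ ∷ []) (neg²1*ℙ d) (subst (_∈ d ⊞ℙ w) (sym p̄₁≡i) i∈d⊞w) (∈-single (1*ℙ w))
    p̄∈[T+1]⊡q (suc (suc zero))       = ∈-cons (_ ∷ []) (neg²1*ℙ 1ℙ) (subst (_∈ 1ℙ ⊞ℙ d) (sym p̄₂≡u) u∈1⊞d) (∈-single (1*ℙ d))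
    p̄∈[T+1]⊡q (suc (suc (suc zero))) = ∈-single (trans (1*ℙ 1ℙ) (sym p̄₃≡1))

    q∈[T+1]⊡r : _∈_⊡_ {n = 1} q (T- -1ℙ) r
    q∈[T+1]⊡r zero             = ∈-single (neg²1*ℙ w)
    q∈[T+1]⊡r (suc zero)       = ∈-cons (_ ∷ []) (neg²1*ℙ 1ℙ) d∈1⊞w (∈-single (1*ℙ w))
    q∈[T+1]⊡r (suc (suc zero)) = ∈-single (1*ℙ 1ℙ)

    -- The value at -1 is w ⊞ (-1), and the imaginary part b > 0 of w keeps w and -1 from being
    -- opposite.
    ¬root-linear : ∀ (s : Polynomial ℙ 1) → coeff s (# 0) ≡ w → coeff s (# 1) ≡ 1ℙ → ¬ Root -1ℙ s
    ¬root-linear s s₀≡w s₁≡1 (x , y , x≡ , y∈ , 0∈) = 0∉w⊞-1 (subst₂ (λ x y → 0ℙ ∈ x ⊞ℙ y)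
      (trans (sym x≡) (trans (*ℙ1 (coeff s (# 0))) s₀≡w))
      (trans (sym (single⇒≡ y∈)) (trans (*-1^1 (coeff s (# 1))) (cong -ℙ_ s₁≡1))) 0∈)

    -- The outer coefficients of a product are single-valued, so a quotient s inherits w and 1;
    -- being linear, it is then T + w.
    quadratic-quotient-mult : ∀ (t : Polynomial ℙ 2) → coeff t (# 0) ≡ w → coeff t (# 2) ≡ 1ℙ →
                              ∀ {k} → k ∈ QuotientMult -1ℙ t → k ℕ.≤ 0
    quadratic-quotient-mult t t₀≡w t₂≡1 (s , t∈ , inj₁ (_ , refl))  = z≤n
    quadratic-quotient-mult t t₀≡w t₂≡1 (s , t∈ , inj₂ (root , _)) = ⊥-elim (¬root-linear s
      (trans (sym (neg²1*ℙ _)) (trans (single⇒≡ (t∈ (# 0))) t₀≡w))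
      (trans (sym (1*ℙ _)) (trans (single⇒≡ (t∈ (# 2))) t₂≡1)) root)

    cubic-quotient-mult : ∀ {k} → k ∈ QuotientMult -1ℙ p̄ → k ℕ.≤ 1
    cubic-quotient-mult (t , p̄∈ , inj₁ (_ , refl)) = z≤n
    cubic-quotient-mult (t , p̄∈ , inj₂ (_ , k , refl , k∈ , _)) = s≤s (quadratic-quotient-mult t
      (trans (sym (neg²1*ℙ _)) (trans (single⇒≡ (p̄∈ (# 0))) p̄₀≡w))
      (trans (sym (1*ℙ _)) (trans (single⇒≡ (p̄∈ (# 3))) p̄₃≡1)) k∈)

    1∈quotient-mult : 1 ∈ QuotientMult -1ℙ p̄
    1∈quotient-mult = q , p̄∈[T+1]⊡q , inj₂ (root-q , 0 , refl
      , (r , q∈[T+1]⊡r , inj₁ (¬root-linear r refl refl , refl)) , quadratic-quotient-mult q refl refl)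

    mult≡2 : Mult -1ℙ p̄ 2
    mult≡2 = inj₂ (root-p̄ , 1 , refl , 1∈quotient-mult , cubic-quotient-mult)

    mult-unique : ∀ {m} → Mult -1ℙ p̄ m → m ≡ 2
    mult-unique (inj₁ (¬root , _)) = ⊥-elim (¬root root-p̄)
    mult-unique (inj₂ (_ , k , refl , k∈ , max)) = cong suc (ℕ.≤-antisym (cubic-quotient-mult k∈) (max 1∈quotient-mult))

-- From phases back to complex coefficients.

module Correspondence (R : RealNumbers) where
  open RealNumbers R
  open SquareRoot R
  open Complex R
  open ModulusProperties
  open IntegerCoefficients R
  open Solver hiding (Polynomial)
  open OrderedField R
  open ComplexPolynomials R

  polar : ∀ z → z ≡ ∣ z ∣ • value (toPhase z)
  polar z with z ≟ℂ 0ℂ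
  ... | yes refl = sym (cong₂ complex (zeroʳ ∣ 0ℂ ∣) (zeroʳ ∣ 0ℂ ∣))
  ... | no  z≢0  = sym (cong₂ complex (cancel (re z)) (cancel (im z)))
    where
    ∣z∣≢0 : ∣ z ∣ ≢ 0#
    ∣z∣≢0 eq = z≢0 (∣∣²≡0⇒≡0 z (trans (sym (∣∣*∣∣ z)) (trans (cong (_* ∣ z ∣) eq) (zeroˡ ∣ z ∣))))
    cancel : ∀ x → ∣ z ∣ * (∣ z ∣ ⁻¹ * x) ≡ x
    cancel x = trans (sym (*-assoc _ _ x)) (trans (cong (_* x) (*-inverseʳ ∣z∣≢0)) (*-identityˡ x))

  -- Identifies the fibre of f over -1 with the negative reals: z is -|z|, and |z| = 0 is impossible
  -- because the phase of 0 is 0.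
  toPhase≡-1⇒negative : ∀ z → toPhase z ≡ -ℙ 1ℙ → ∃[ x ] x < 0# × z ≡ ofℝ x
  toPhase≡-1⇒negative z eq = - r , -r<0 , z≡
    where
    r = ∣ z ∣
    z≡ : z ≡ ofℝ (- r)
    z≡ = trans (polar z) (trans (cong (λ φ → r • value φ) eq) (cong₂ complex
      (solve 1 (λ r → r :* (:- con (pos 1)) := :- r) refl r)
      (solve 1 (λ r → r :* (:- con (pos 0)) := con (pos 0)) refl r)))
    toPhase-0 : toPhase 0ℂ ≡ 0ℙ
    toPhase-0 with 0ℂ ≟ℂ 0ℂ
    ... | yes _   = refl
    ... | no  0≢0 = ⊥-elim (0≢0 refl)
    -r≢0 : - r ≢ 0#
    -r≢0 -r≡0 = 1≢0 (trans (solve 1 (λ o → o := :- (:- o)) refl 1#)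
      (trans (cong (-_ ∘ re ∘ value) (trans (sym eq) (trans (cong toPhase (trans z≡ (cong ofℝ -r≡0))) toPhase-0)))
             (solve 0 (:- con (pos 0) := con (pos 0)) refl)))
    -r<0 : - r < 0#
    -r<0 = 0≤y-x⇒x≤y (subst (0# ≤_) (solve 1 (λ r → r := con (pos 0) :- (:- r)) refl r) (∣∣-nonneg z)) , -r≢0

  shape : ∀ {a b} (p : Polynomial ℂ-hyperfield 3) (p̄ : Polynomial ℙ 3) → Corresponds toPhase p p̄ →
          value (coeff p̄ (# 3)) ≡ 1ℂ → value (coeff p̄ (# 2)) ≡ complex a b →
          value (coeff p̄ (# 1)) ≡ i· 1# → value (coeff p̄ (# 0)) ≡ complex (- a) b → Shape a b p
  shape p p̄ corresponds c₃ c₂ c₁ c₀ = record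
    { r₀      = ∣ coeff p (# 0) ∣
    ; r₂      = ∣ coeff p (# 2) ∣
    ; im-c₃≡0 = trans (cong im (coeff≡ (# 3) c₃)) (zeroʳ _)
    ; c₂≡     = coeff≡ (# 2) c₂
    ; re-c₁≡0 = trans (cong re (coeff≡ (# 1) c₁)) (zeroʳ _)
    ; c₀≡     = coeff≡ (# 0) c₀
    }
    where
    coeff≡ : ∀ i {z} → value (coeff p̄ i) ≡ z → coeff p i ≡ ∣ coeff p i ∣ • z
    coeff≡ i refl = trans (polar (coeff p i)) (cong (λ φ → ∣ coeff p i ∣ • value φ) (corresponds i))

mainTheorem2 : ExcludedMiddle 0ℓ →
    (R : RealNumbers) →
    let open RealNumbers R
        open Complex R in
    (exp : ℂ → ℂ) → IsExponential exp →
    (π : ℝ) → IsPi exp π →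
    (p̄ : Polynomial ℙ 3) →
    value (coeff p̄ (# 3)) ≡ 1ℂ →
    value (coeff p̄ (# 2)) ≡ exp (i· (π / 24)) →
    value (coeff p̄ (# 1)) ≡ exp (i· (π / 2)) →
    value (coeff p̄ (# 0)) ≡ exp (i· (fromℕ 23 * π / 24)) →
    Mult (-ℙ 1ℙ) p̄ 2
    × (∀ (p : Polynomial ℂ-hyperfield 3) → Corresponds toPhase p p̄ →
         ∃[ s ] MultSum (λ a → ∃[ x ] x < 0# × a ≡ ofℝ x) p s × 2 > s)
    × ¬ (∃[ p ] Corresponds {ℂ-hyperfield} toPhase p p̄ ×
         ∃[ m ] Mult (-ℙ 1ℙ) p̄ m × MultSum (λ a → toPhase a ≡ -ℙ 1ℙ) p m)
mainTheorem2 em R exp isExponential π isPi p̄ c₃ c₂ c₁ c₀ =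
    mult≡2
  , (λ p corresponds → Roots.negative-mult-sum b≢0 p (shape′ p corresponds) em)
  , λ (p , corresponds , m , mult , ams , unique , mults , _ , sum≡m) →
      -- Equality would make the multiplicity 2 equal to a sum that is at most 1.
      ℕ.<-irrefl refl (subst (ℕ._≤ 1) (trans sum≡m (mult-unique mult))
        (Roots.mult-sum≤1 b≢0 p (shape′ p corresponds) ams unique
          (All.map (map₁ (toPhase≡-1⇒negative _)) mults)))
  where
  open RealNumbers R
  open Complex R
  open OrderedField R
  open PhaseHyperfield R
  open ComplexPolynomials R
  open Correspondence R
  open Angles R exp isExponential π isPi

  u v : ℂ
  u = exp (i· (π / 24))
  v = exp (i· (π / 2))

  0<b : 0# < im u
  -- The argument counts from denominator 2, so 22 stands for π/24; in `re-/-pos` it counts from 3,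
  -- hence 21 there.
  0<b = sin-/-pos 22

  b≢0 : im u ≢ 0#
  b≢0 = pos⇒≢0 0<b

  ∣u∣²≡1 : ∣ u ∣² ≡ 1#
  ∣u∣²≡1 = subst (λ z → ∣ z ∣² ≡ 1#) c₂ (unit (coeff p̄ (# 2)) λ eq → b≢0 (cong im (trans (sym c₂) eq)))

  ∣v∣²≡1 : ∣ v ∣² ≡ 1#
  ∣v∣²≡1 = subst (λ z → ∣ z ∣² ≡ 1#) c₁ (unit (coeff p̄ (# 1)) λ eq → pos⇒≢0 (sin-/-pos 0) (cong im (trans (sym c₁) eq)))

  c₁≡i : value (coeff p̄ (# 1)) ≡ i· 1#
  c₁≡i = trans c₁ (exp-iπ/2 ∣v∣²≡1)

  c₀≡-ū : value (coeff p̄ (# 0)) ≡ complex (- re u) (im u)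
  c₀≡-ū = trans c₀ (exp-reflect 22 ∣v∣²≡1 ∣u∣²≡1)

  open Cubic (re-/-pos 21) 0<b ∣u∣²≡1 p̄ c₃ c₂ c₁≡i c₀≡-ū using (mult≡2; mult-unique)

  shape′ : ∀ p → Corresponds toPhase p p̄ → Shape (re u) (im u) p
  shape′ p corresponds = shape p p̄ corresponds c₃ c₂ c₁≡i c₀≡-ū
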